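{- Let $n \ge 1$ and $\omega \in \mathfrak{S}_n$. Then for each nonnegative integer $g$, we have $$a_g(\omega) = md_g(\omega).$$
   Context: Permutations in the symmetric group $\mathfrak{S}_n$ on $[n]=\{1,\dots,n\}$ are multiplied from left to right. A transposition is written $(a\,b)$ with $a<b$. For $\omega\in\mathfrak{S}_n$, $c(\omega)$ denotes the number of cycles of $\omega$ (fixed points included). A genus $g$ monotone double Hurwitz factorisation of $\omega$ is a tuple $(\sigma,(a_1\,b_1),\dots,(a_m\,b_m))$ with $\sigma(a_1\,b_1)\cdots(a_m\,b_m)=\omega$ such that: $\sigma$ is an $n$-cycle; $m=c(\omega)-1+2g$; and $b_1\le b_2\le\cdots\le b_m$. Let $md_g(\omega)$ be the number of such tuples. A genus $g$ transitive star factorisation of $\omega$ is a tuple of transpositions $((a_1\,n),(a_2\,n),\dots,(a_m\,n))$ (each containing the symbol $n$) with $(a_1\,n)(a_2\,n)\cdots(a_m\,n)=\omega$ such that $m=n+c(\omega)-2+2g$ and the set of factors generates a subgroup acting transitively on $[n]$ (equivalently, each transposition $(i\,n)$, $1\le i\le n-1$, occurs among the factors). Let $a_g(\omega)$ be the number of such tuples. -}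

module Defs where

open import Data.Nat using (ℕ; zero; suc; _+_; _*_; _∸_; _≤_; _<_)
import Data.Nat.Properties as ℕP
open import Data.Fin using (Fin; toℕ; fromℕ; inject₁) renaming (_<_ to _<ᶠ_)
import Data.Fin.Properties as FinP
open import Data.Fin.Permutation using (Permutation′; _⟨$⟩ʳ_; transpose)
open import Data.List using (List; []; _∷_; map; concatMap; filter; length; allFin; upTo; cartesianProduct)
open import Data.List.Relation.Unary.All using (All; all?)
open import Data.List.Relation.Unary.Any using (Any)
open import Data.List.Membership.Propositional using (_∈_)
import Data.List.Membership.DecPropositional as MemDec
open import Data.List.Relation.Unary.Unique.Propositional using (Unique)
import Data.List.Relation.Unary.Unique.DecPropositional as UDec
open import Data.Vec using (Vec; lookup; toList) renaming ([] to []ᵥ; _∷_ to _∷ᵥ_)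
open import Data.Product using (Σ; _×_; _,_; proj₁; proj₂)
open import Data.Unit using (⊤; tt)
open import Function using (id; _∘_)
open import Relation.Binary.PropositionalEquality using (_≡_)
open import Relation.Nullary using (Dec; yes; no; _×-dec_)
open import Relation.Unary using (Decidable)

-- Conventions.
-- The symbol set [n] = {1,…,n} is modelled by Fin n (symbol i ↔ index i-1;
-- the order is preserved).  Permutations act on the left as functions, and
-- products are taken from LEFT TO RIGHT: in a product  π₁ π₂ ⋯ π_r  the factor
-- π₁ is applied first.  Thus (π₁ π₂ ⋯ π_r)(x) = π_r( ⋯ π₂(π₁ x) ⋯ ).

Fun : ℕ → Set
Fun n = Fin n → Fin n

prod : ∀ {n} → List (Fun n) → Fun n
prod []       x = x
prod (f ∷ fs) x = prod fs (f x)

_≗ᶠ_ : ∀ {n} → Fun n → Fun n → Set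
_≗ᶠ_ {n} f h = All (λ x → f x ≡ h x) (allFin n)

_≗ᶠ?_ : ∀ {n} (f h : Fun n) → Dec (f ≗ᶠ h)
f ≗ᶠ? h = all? (λ x → f x FinP.≟ h x) _

iter : ∀ {n} → Fun n → ℕ → Fun n
iter f zero    x = x
iter f (suc k) x = f (iter f k x)

-- Number of cycles c(ω) (fixed points included).  Each cycle (orbit) of a
-- permutation f of Fin n is the set {f^j x | j < n}; we count the cycles by
-- counting their least elements: x is the least element of its cycle iff
-- x ≤ f^j x for all j < n.

IsCycleMin : ∀ {n} → Fun n → Fin n → Set
IsCycleMin {n} f x = All (λ j → toℕ x ≤ toℕ (iter f j x)) (upTo n)

isCycleMin? : ∀ {n} (f : Fun n) → Decidable (IsCycleMin f)
isCycleMin? {n} f x = all? (λ j → toℕ x ℕP.≤? toℕ (iter f j x)) (upTo n)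

cycles : ∀ {n} → Fun n → ℕ
cycles {n} f = length (filter (isCycleMin? f) (allFin n))

c : ∀ {n} → Permutation′ n → ℕ
c ω = cycles (ω ⟨$⟩ʳ_)

listsOf : ∀ {A : Set} → List A → ℕ → List (List A)
listsOf xs zero    = [] ∷ []
listsOf xs (suc m) = concatMap (λ x → map (x ∷_) (listsOf xs m)) xs

vecsOf : ∀ {A : Set} → List A → (m : ℕ) → List (Vec A m)
vecsOf xs zero    = []ᵥ ∷ []
vecsOf xs (suc m) = concatMap (λ x → map (x ∷ᵥ_) (vecsOf xs m)) xs

-- all permutations of Fin n in one-line notation: vectors (σ(1),…,σ(n))
-- whose entries are pairwise distinct (each such vector is listed once)
PermVec : ℕ → Set
PermVec n = Vec (Fin n) n

IsPermVec : ∀ {n} → PermVec n → Set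
IsPermVec v = Unique (toList v)

isPermVec? : ∀ {n} → Decidable (IsPermVec {n})
isPermVec? v = UDec.unique? FinP._≟_ (toList v)

allPerms : (n : ℕ) → List (PermVec n)
allPerms n = filter isPermVec? (vecsOf (allFin n) n)

Trans : ℕ → Set
Trans n = Fin n × Fin n

IsTrans : ∀ {n} → Trans n → Set
IsTrans (a , b) = a <ᶠ b

allTrans : (n : ℕ) → List (Trans n)
allTrans n = filter (λ p → FinP._<?_ (proj₁ p) (proj₂ p))
                    (cartesianProduct (allFin n) (allFin n))

tr : ∀ {n} → Trans n → Fun n
tr (a , b) = transpose a b ⟨$⟩ʳ_

Monotone : ∀ {n} → List (Trans n) → Set
Monotone []                    = ⊤
Monotone (_ ∷ [])              = ⊤
Monotone (p ∷ q ∷ ps)          = (toℕ (proj₂ p) ≤ toℕ (proj₂ q)) × Monotone (q ∷ ps)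

monotone? : ∀ {n} → Decidable (Monotone {n})
monotone? []           = yes tt
monotone? (_ ∷ [])     = yes tt
monotone? (p ∷ q ∷ ps) = (toℕ (proj₂ p) ℕP.≤? toℕ (proj₂ q)) ×-dec monotone? (q ∷ ps)

-- Monotone double Hurwitz numbers md_g(ω).
-- Tuples (σ, (a₁ b₁), …, (a_m b_m)) with σ an n-cycle (i.e. a permutation
-- with exactly one cycle), m = c(ω) − 1 + 2g, b₁ ≤ ⋯ ≤ b_m, and
-- σ (a₁ b₁) ⋯ (a_m b_m) = ω.

MDCond : ∀ {n} → Permutation′ n → PermVec n × List (Trans n) → Set
MDCond ω (σ , ts) =
  (cycles (lookup σ) ≡ 1) × Monotone ts
    × (prod (lookup σ ∷ map tr ts) ≗ᶠ (ω ⟨$⟩ʳ_))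

mdCond? : ∀ {n} (ω : Permutation′ n) → Decidable (MDCond ω)
mdCond? ω (σ , ts) =
  (cycles (lookup σ) ℕP.≟ 1) ×-dec monotone? ts
    ×-dec (prod (lookup σ ∷ map tr ts) ≗ᶠ? (ω ⟨$⟩ʳ_))

md : ∀ {n} → ℕ → Permutation′ n → ℕ
md {n} g ω =
  length (filter (mdCond? ω)
    (cartesianProduct (allPerms n) (listsOf (allTrans n) (c ω ∸ 1 + 2 * g))))

-- Transitive star factorisations a_g(ω), for n = suc k.
-- The symbol n is  fromℕ k : Fin (suc k); a star transposition (a n) with
-- a < n is encoded by  a : Fin k  (acting as the transposition of
-- inject₁ a and fromℕ k).  Tuples ((a₁ n), …, (a_m n)) with
-- m = n + c(ω) − 2 + 2g, product ω, and every (i n), 1 ≤ i ≤ n−1, occurring.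

star : ∀ {k} → Fin k → Fun (suc k)
star {k} a = transpose (inject₁ a) (fromℕ k) ⟨$⟩ʳ_

StarCond : ∀ {k} → Permutation′ (suc k) → List (Fin k) → Set
StarCond {k} ω as =
  (prod (map star as) ≗ᶠ (ω ⟨$⟩ʳ_)) × All (_∈ as) (allFin k)

starCond? : ∀ {k} (ω : Permutation′ (suc k)) → Decidable (StarCond ω)
starCond? {k} ω as =
  (prod (map star as) ≗ᶠ? (ω ⟨$⟩ʳ_)) ×-dec all? (λ i → MemDec._∈?_ (FinP._≟_ {k}) i as) (allFin k)

a : ∀ {k} → ℕ → Permutation′ (suc k) → ℕ
a {k} g ω =
  length (filter (starCond? ω) (listsOf (allFin k) (suc k + c ω ∸ 2 + 2 * g)))

{-# OPTIONS --safe #-}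

-- In the group algebra, with J_b = Σ_{a<b} (a b) the Jucys–Murphy elements,
-- the n-cycles sum to J_2 ⋯ J_n and the monotone words of length m sum to
-- h_m(J_2, …, J_n); so md counts A_n(m) = J_2 ⋯ J_n h_m(J_2, …, J_n), and
-- A_n(m) = (A_n(m−1) + A_{n−1}(m)) J_n.  Since A_n is symmetric in consecutive
-- J_b, it commutes with the adjacent transpositions, hence does not depend on
-- how the symbols are ordered.
-- In a transitive star word of length n − 1 + m the first letter (x n) either
-- recurs or not.  If not, what follows is a transitive star word W on the
-- symbols other than x, and (x n) W = W′ (x n) with W′ centred at x and
-- avoiding n.  By induction such W′ sum to A_{n−1}(m), whatever x is, so star
-- words obey the same recursion.
module Submission where

open import Defs
open import Level using (0ℓ)
open import Algebra.Bundles using (Semiring)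
import Algebra.Definitions as AlgDefs
import Algebra.Properties.CommutativeSemigroup as CommutativeSemigroupP
open import Data.Bool.Base using (Bool; true; false; if_then_else_; _∧_; _∨_; not)
open import Data.Bool.Properties using (∧-assoc; ∧-comm)
open import Data.Nat using (ℕ; zero; suc; _+_; _*_; _∸_; _≤_; _<_; z≤n; s≤s)
import Data.Nat.Properties as ℕP
open import Data.Fin using (Fin; toℕ; fromℕ; fromℕ<; inject₁)
open import Data.Fin.Permutation using (Permutation′; _⟨$⟩ʳ_)
open import Data.Fin.Relation.Unary.Top using (view; ‵fromℕ; ‵inject₁)
import Data.Fin.Properties as FinP
import Data.Fin.Permutation.Components as PC
open import Data.List using (List; []; _∷_; _++_; map; concatMap; filter; length; _∷ʳ_; allFin; upTo; cartesianProduct)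
open import Data.List.Membership.Propositional using (_∈_; _∉_; find; lose)
open import Data.List.Membership.Propositional.Properties
  using (∈-map⁺; ∈-map⁻; ∈-filter⁺; ∈-filter⁻; ∈-++⁺ʳ; ∈-cartesianProduct⁺; ∈-allFin; ∈-upTo⁺; ∈-concatMap⁺; ∈-concatMap⁻; ∈-length)
open import Data.List.Membership.Propositional.Properties.WithK using (unique∧set⇒bag)
open import Data.List.Relation.Unary.All as All using (All; []; _∷_)
import Data.List.Relation.Unary.All.Properties as AllP
open import Data.List.Relation.Unary.Any using (here; there)
open import Data.List.Relation.Unary.AllPairs as AllPairs using ([]; _∷_)
open import Data.List.Relation.Unary.Unique.Propositional using (Unique)
import Data.List.Properties as ListP
import Data.List.Membership.DecPropositional as MemDec
import Data.List.Relation.Unary.Unique.Propositional.Properties as UniqueP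
open import Data.List.Relation.Binary.BagAndSetEquality using (∼bag⇒↭)
open import Data.List.Relation.Binary.Permutation.Propositional
  using (_↭_; refl; prep; swap; trans; ↭-sym; ↭-refl; ↭⇒↭ₛ)
import Data.List.Relation.Binary.Permutation.Propositional.Properties as PermP
import Data.List.Relation.Binary.Permutation.Setoid.Properties as PermSetoidP
open import Data.Nat.Induction using (<-rec)
open import Data.Vec as Vec using (Vec)
import Data.Vec.Properties as VecP
import Data.Vec.Relation.Unary.All.Properties as VecAllP
import Data.Vec.Relation.Unary.AllPairs as VecAllPairs
import Data.Vec.Relation.Unary.Unique.Propositional as VecUnique
import Data.Vec.Relation.Unary.Unique.Propositional.Properties as VecUniqueP
open import Data.Sum using (inj₁; inj₂)
open import Data.Product using (_×_; _,_; proj₁; proj₂; ∃)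
open import Function using (_∘_; id)
open import Function.Bundles using (_⇔_; mk⇔)
import Relation.Binary.Reasoning.Setoid as SetoidReasoning
open import Relation.Binary.PropositionalEquality as ≡
  using (_≡_; _≢_; refl; cong; cong₂; subst)
open import Relation.Nullary using (Dec; does; yes; no; ¬_; ¬?; contradiction; _×-dec_)
open import Relation.Nullary.Decidable using (dec-true; dec-false; does-⇔)

-- Symmetry in the Jucys-Murphy elements does not yield commutation by relabelling alone: with s =
-- (c d) for consecutive symbols c, d and x, y their elements, s x s is y - s and not y. What does
-- commute with s is x + y and xy. Since the coefficients of A are not given as polynomials in these
-- two, the commutation is proved by induction on m, along a linear recurrence of order two whose
-- coefficients are x + y and xy. Words are counted by natural numbers, so all identities live in a
-- semiring: the negative term of the recurrence is moved to the other side, and additive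
-- cancellation replaces subtraction. Order independence is needed because moving (x n) across W
-- makes x the centre, and x need not be the largest of the remaining symbols, as the head of a
-- Jucys-Murphy list would be.

-- Duplicate-free lists up to permutation

unique-set⇒↭ : {X : Set} {xs ys : List X} → Unique xs → Unique ys →
  (∀ {z} → z ∈ xs → z ∈ ys) → (∀ {z} → z ∈ ys → z ∈ xs) → xs ↭ ys
unique-set⇒↭ u v to from = ∼bag⇒↭ (unique∧set⇒bag u v (mk⇔ to from))

Unique-resp-↭ : {X : Set} {xs ys : List X} → xs ↭ ys → Unique xs → Unique ys
Unique-resp-↭ p = PermSetoidP.Unique-resp-↭ (≡.setoid _) (↭⇒↭ₛ p)

-- Transpositions and their conjugates

tr-eqˡ : ∀ {n} (a b : Fin n) → tr (a , b) a ≡ b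
tr-eqˡ a b rewrite dec-true (a FinP.≟ a) refl = refl

tr-eqʳ : ∀ {n} (a b : Fin n) → tr (a , b) b ≡ a
tr-eqʳ a b with b FinP.≟ a
... | yes b≡a = b≡a
... | no _ rewrite dec-true (b FinP.≟ b) refl = refl

tr-neq : ∀ {n} {a b x : Fin n} → x ≢ a → x ≢ b → tr (a , b) x ≡ x
tr-neq {a = a} {b} {x} x≢a x≢b
  rewrite dec-false (x FinP.≟ a) x≢a | dec-false (x FinP.≟ b) x≢b = refl

tr-sym : ∀ {n} (a b x : Fin n) → tr (a , b) x ≡ tr (b , a) x
tr-sym a b x = by-cases (x FinP.≟ a) (x FinP.≟ b)
  where
  by-cases : Dec (x ≡ a) → Dec (x ≡ b) → tr (a , b) x ≡ tr (b , a) x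
  by-cases (yes refl) _          = ≡.trans (tr-eqˡ a b) (≡.sym (tr-eqʳ b a))
  by-cases (no _)     (yes refl) = ≡.trans (tr-eqʳ a b) (≡.sym (tr-eqˡ b a))
  by-cases (no x≢a)   (no x≢b)   = ≡.trans (tr-neq x≢a x≢b) (≡.sym (tr-neq x≢b x≢a))

tr-involutive : ∀ {n} (a b x : Fin n) → tr (a , b) (tr (a , b) x) ≡ x
tr-involutive a b x = ≡.trans (tr-sym a b (tr (a , b) x)) (PC.transpose-inverse b a)

tr-injective : ∀ {n} (a b : Fin n) {x y} → tr (a , b) x ≡ tr (a , b) y → x ≡ y
tr-injective a b {x} {y} eq =
  ≡.trans (≡.sym (tr-involutive a b x)) (≡.trans (cong (tr (a , b)) eq) (tr-involutive a b y))

-- Read from left to right, this moves (a b) past (c d) at the price of relabelling c and d by (a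
-- b). With involutivity it is all that the algebraic part knows about transpositions.
tr-conj : ∀ {n} (a b c d x : Fin n) →
  tr (c , d) (tr (a , b) x) ≡ tr (a , b) (tr (tr (a , b) c , tr (a , b) d) x)
tr-conj {n} a b c d x = by-cases (τ x FinP.≟ c) (τ x FinP.≟ d)
  where
  open ≡.≡-Reasoning
  τ : Fin n → Fin n
  τ = tr (a , b)
  shift : ∀ {y} → τ x ≡ y → x ≡ τ y
  shift eq = ≡.trans (≡.sym (tr-involutive a b x)) (cong τ eq)
  unshift : ∀ {y} → τ x ≢ y → x ≢ τ y
  unshift neq eq = neq (≡.trans (cong τ eq) (tr-involutive a b _))
  by-cases : Dec (τ x ≡ c) → Dec (τ x ≡ d) → tr (c , d) (τ x) ≡ τ (tr (τ c , τ d) x)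
  by-cases (yes τx≡c) _ = begin
    tr (c , d) (τ x)          ≡⟨ cong (tr (c , d)) τx≡c ⟩
    tr (c , d) c              ≡⟨ tr-eqˡ c d ⟩
    d                         ≡⟨ tr-involutive a b d ⟨
    τ (τ d)                   ≡⟨ cong τ (tr-eqˡ (τ c) (τ d)) ⟨
    τ (tr (τ c , τ d) (τ c))  ≡⟨ cong (τ ∘ tr (τ c , τ d)) (shift τx≡c) ⟨
    τ (tr (τ c , τ d) x)      ∎
  by-cases (no _) (yes τx≡d) = begin
    tr (c , d) (τ x)          ≡⟨ cong (tr (c , d)) τx≡d ⟩
    tr (c , d) d              ≡⟨ tr-eqʳ c d ⟩
    c                         ≡⟨ tr-involutive a b c ⟨
    τ (τ c)                   ≡⟨ cong τ (tr-eqʳ (τ c) (τ d)) ⟨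
    τ (tr (τ c , τ d) (τ d))  ≡⟨ cong (τ ∘ tr (τ c , τ d)) (shift τx≡d) ⟨
    τ (tr (τ c , τ d) x)      ∎
  by-cases (no τx≢c) (no τx≢d) =
    ≡.trans (tr-neq τx≢c τx≢d) (cong τ (≡.sym (tr-neq (unshift τx≢c) (unshift τx≢d))))

map-tr-↭ : ∀ {n} {a b : Fin n} {U} → Unique U → a ∈ U → b ∈ U → map (tr (a , b)) U ↭ U
map-tr-↭ {a = a} {b} {U} uU a∈U b∈U =
  unique-set⇒↭ (UniqueP.map⁺ (tr-injective a b) uU) uU to from
  where
  stays : ∀ {x} → x ∈ U → tr (a , b) x ∈ U
  stays {x} x∈U = by-cases (x FinP.≟ a) (x FinP.≟ b)
    where
    by-cases : Dec (x ≡ a) → Dec (x ≡ b) → tr (a , b) x ∈ U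
    by-cases (yes refl) _          = subst (_∈ U) (≡.sym (tr-eqˡ x b)) b∈U
    by-cases (no _)     (yes refl) = subst (_∈ U) (≡.sym (tr-eqʳ a x)) a∈U
    by-cases (no x≢a)   (no x≢b)   = subst (_∈ U) (≡.sym (tr-neq x≢a x≢b)) x∈U
  to : ∀ {y} → y ∈ map (tr (a , b)) U → y ∈ U
  to y∈ with ∈-map⁻ (tr (a , b)) y∈
  ... | _ , x∈U , refl = stays x∈U
  from : ∀ {y} → y ∈ U → y ∈ map (tr (a , b)) U
  from {y} y∈U = subst (_∈ map (tr (a , b)) U) (tr-involutive a b y) (∈-map⁺ (tr (a , b)) (stays y∈U))

map-tr-fixed : ∀ {n} {a b : Fin n} {U} → a ∉ U → b ∉ U → map (tr (a , b)) U ≡ U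
map-tr-fixed {U = []}    _   _   = refl
map-tr-fixed {U = x ∷ U} a∉U b∉U = cong₂ _∷_
  (tr-neq (λ { refl → a∉U (here refl) }) (λ { refl → b∉U (here refl) }))
  (map-tr-fixed (a∉U ∘ there) (b∉U ∘ there))

-- Words that use every letter of a set

_∈?_ : ∀ {k} (x : Fin k) (w : List (Fin k)) → Dec (x ∈ w)
_∈?_ = MemDec._∈?_ FinP._≟_

covers? : ∀ {k} (S w : List (Fin k)) → Dec (All (_∈ w) S)
covers? S w = All.all? (_∈? w) S

infixl 6 _─_

_─_ : ∀ {k} → List (Fin k) → Fin k → List (Fin k)
S ─ x = filter (λ y → ¬? (x FinP.≟ y)) S

─-unique : ∀ {k} (x : Fin k) {S} → Unique S → Unique (S ─ x)
─-unique x = UniqueP.filter⁺ (λ y → ¬? (x FinP.≟ y))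

─-↭ : ∀ {k} {x : Fin k} {S} → Unique S → x ∈ S → S ↭ x ∷ S ─ x
─-↭ {x = x} {S} u x∈S =
  unique-set⇒↭ u (All.tabulate (λ y∈ → proj₂ (∈-filter⁻ P? {xs = S} y∈)) ∷ ─-unique x u) to from
  where
  P? : ∀ y → Dec (x ≢ y)
  P? y = ¬? (x FinP.≟ y)
  to : ∀ {y} → y ∈ S → y ∈ x ∷ S ─ x
  to {y} y∈S with x FinP.≟ y
  ... | yes refl = here refl
  ... | no x≢y   = there (∈-filter⁺ P? y∈S x≢y)
  from : ∀ {y} → y ∈ x ∷ S ─ x → y ∈ S
  from (here refl) = x∈S
  from (there y∈)  = proj₁ (∈-filter⁻ P? y∈)

length-─ : ∀ {k} {x : Fin k} {S} → Unique S → x ∈ S → length S ≡ suc (length (S ─ x))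
length-─ u x∈S = PermP.↭-length (─-↭ u x∈S)

covers-drop-∈ : ∀ {k} {x : Fin k} {S w} → x ∈ w → All (_∈ x ∷ w) S → All (_∈ w) S
covers-drop-∈ x∈w = All.map (λ { (here refl) → x∈w ; (there y∈w) → y∈w })

covers-remove : ∀ {k} {x : Fin k} {S w} → x ∉ w → All (_∈ x ∷ w) S → All (_∈ w) (S ─ x)
covers-remove {x = x} {S} {w} x∉w cov = All.tabulate λ y∈ →
  let y∈S , x≢y = ∈-filter⁻ (λ y → ¬? (x FinP.≟ y)) {xs = S} y∈ in
  strip x≢y (All.lookup cov y∈S)
  where
  strip : ∀ {y} → x ≢ y → y ∈ x ∷ w → y ∈ w
  strip x≢y (here refl) = contradiction refl x≢y
  strip x≢y (there y∈w) = y∈w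

covers-restore : ∀ {k} {x : Fin k} {S w} → All (_∈ w) (S ─ x) → All (_∈ x ∷ w) S
covers-restore {x = x} {S} {w} cov = All.tabulate restore
  where
  restore : ∀ {y} → y ∈ S → y ∈ x ∷ w
  restore {y} y∈S with x FinP.≟ y
  ... | yes refl = here refl
  ... | no x≢y   = there (All.lookup cov (∈-filter⁺ (λ y → ¬? (x FinP.≟ y)) y∈S x≢y))

not-∨ : ∀ a b → not (a ∨ b) ≡ not a ∧ not b
not-∨ true  b = refl
not-∨ false b = refl

-- Initial lists of symbols

-- The lists j − 1, …, 1, 0.
data Initial {n : ℕ} : List (Fin n) → Set where
  []  : Initial []
  _∷_ : ∀ {c U} → toℕ c ≡ length U → Initial U → Initial (c ∷ U)

initial-< : ∀ {n} {U : List (Fin n)} → Initial U → ∀ {x} → x ∈ U → toℕ x < length U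
initial-< (eq ∷ i) (here refl) = s≤s (ℕP.≤-reflexive eq)
initial-< (eq ∷ i) (there x∈U) = ℕP.m<n⇒m<1+n (initial-< i x∈U)

initial-∈ : ∀ {n} {U : List (Fin n)} → Initial U → ∀ {x} → toℕ x < length U → x ∈ U
initial-∈ (eq ∷ i) x<  with ℕP.m<1+n⇒m<n∨m≡n x<
... | inj₁ x<U = there (initial-∈ i x<U)
... | inj₂ x≡  = here (FinP.toℕ-injective (≡.trans x≡ (≡.sym eq)))

initial-unique : ∀ {n} {U : List (Fin n)} → Initial U → Unique U
initial-unique []       = []
initial-unique (eq ∷ i) =
  All.tabulate (λ { x∈U refl → ℕP.<-irrefl eq (initial-< i x∈U) }) ∷ initial-unique i

initial-exists : ∀ {n} j → j ≤ n → ∃ λ (U : List (Fin n)) → Initial U × length U ≡ j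
initial-exists zero    _   = [] , [] , refl
initial-exists (suc j) j<n with initial-exists j (ℕP.<⇒≤ j<n)
... | U , i , eq = fromℕ< j<n ∷ U , ≡.trans (FinP.toℕ-fromℕ< j<n) (≡.sym eq) ∷ i , cong suc eq

-- Monotone words, decomposed at the last letter

Below : ∀ {n} → ℕ → Trans n → Set
Below j p = toℕ (proj₂ p) < j

below? : ∀ {n} j (p : Trans n) → Dec (Below j p)
below? j p = toℕ (proj₂ p) ℕP.<? j

MonotoneBelow : ∀ {n} → ℕ → List (Trans n) → Set
MonotoneBelow j w = Monotone w × All (Below j) w

monotoneBelow? : ∀ {n} j (w : List (Trans n)) → Dec (MonotoneBelow j w)
monotoneBelow? j w = monotone? w ×-dec All.all? (below? j) w

monotone-∷ʳ⁺ : ∀ {n} (w : List (Trans n)) p → MonotoneBelow (suc (toℕ (proj₂ p))) w → Monotone (w ∷ʳ p)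
monotone-∷ʳ⁺ []          p _                              = _
monotone-∷ʳ⁺ (q ∷ [])    p (_ , q<p ∷ _)                  = ℕP.≤-pred q<p , _
monotone-∷ʳ⁺ (q ∷ r ∷ w) p ((q≤r , mono) , _ ∷ below)     = q≤r , monotone-∷ʳ⁺ (r ∷ w) p (mono , below)

monotone-∷ʳ⁻ : ∀ {n} (w : List (Trans n)) p → Monotone (w ∷ʳ p) → MonotoneBelow (suc (toℕ (proj₂ p))) w
monotone-∷ʳ⁻ []          p _            = _ , []
monotone-∷ʳ⁻ (q ∷ [])    p (q≤p , _)    = _ , s≤s q≤p ∷ []
monotone-∷ʳ⁻ (q ∷ r ∷ w) p (q≤r , mono) with monotone-∷ʳ⁻ (r ∷ w) p mono
... | mono′ , r<p ∷ below = (q≤r , mono′) , ℕP.≤-<-trans q≤r r<p ∷ r<p ∷ below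

-- The last letter carries the largest b, so it alone decides the bound j, and it leaves a word of
-- the same kind in front. The new bound is b + 1 because `Below` is strict while monotonicity is
-- weak.
monotoneBelow-∷ʳ : ∀ {n} j (w : List (Trans n)) p →
  MonotoneBelow j (w ∷ʳ p) ⇔ (Below j p × MonotoneBelow (suc (toℕ (proj₂ p))) w)
monotoneBelow-∷ʳ j w p = mk⇔
  (λ (mono , below) → All.lookup below (∈-++⁺ʳ w (here refl)) , monotone-∷ʳ⁻ w p mono)
  (λ (p<j , mono , below) → monotone-∷ʳ⁺ w p (mono , below) ,
    AllP.∷ʳ⁺ (All.map (λ q<p → ℕP.<-≤-trans q<p p<j) below) p<j)

-- In an initial list the entries after c are exactly the symbols smaller than c. This is how the
-- order condition a < b turns into the sum `J c U`.
allTrans-ending-↭ : ∀ {n} {c : Fin n} {U} → Initial (c ∷ U) →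
  filter (λ p → proj₂ p FinP.≟ c) (allTrans n) ↭ map (_, c) U
allTrans-ending-↭ {n} {c} {U} (eq ∷ i) = unique-set⇒↭
  (UniqueP.filter⁺ _ (UniqueP.filter⁺ _ (UniqueP.cartesianProduct⁺ (UniqueP.allFin⁺ n) (UniqueP.allFin⁺ n))))
  (UniqueP.map⁺ (cong proj₁) (initial-unique i)) to from
  where
  to : ∀ {p} → p ∈ filter (λ p → proj₂ p FinP.≟ c) (allTrans n) → p ∈ map (_, c) U
  to p∈ with ∈-filter⁻ (λ p → proj₂ p FinP.≟ c) {xs = allTrans n} p∈
  ... | p∈all , refl = ∈-map⁺ (_, c) (initial-∈ i (subst (_ <_) eq
    (proj₂ (∈-filter⁻ (λ p → proj₁ p FinP.<? proj₂ p) {xs = cartesianProduct (allFin n) (allFin n)} p∈all))))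
  from : ∀ {p} → p ∈ map (_, c) U → p ∈ filter (λ p → proj₂ p FinP.≟ c) (allTrans n)
  from p∈ with ∈-map⁻ (_, c) p∈
  ... | a , a∈U , refl = ∈-filter⁺ (λ p → proj₂ p FinP.≟ c)
    (∈-filter⁺ (λ p → proj₁ p FinP.<? proj₂ p) (∈-cartesianProduct⁺ (∈-allFin a) (∈-allFin c))
      (subst (toℕ a <_) (≡.sym eq) (initial-< i a∈U))) refl

-- Enumeration of permutations in one-line notation

concatMap-unique : {X Y : Set} (f : X → List Y) {xs : List X} → Unique xs →
  (∀ {x} → x ∈ xs → Unique (f x)) →
  (∀ {x y z} → x ∈ xs → y ∈ xs → z ∈ f x → z ∈ f y → x ≡ y) → Unique (concatMap f xs)
concatMap-unique f {[]}     _          _  _   = []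
concatMap-unique f {x ∷ xs} u@(_ ∷ u′) uf det = UniqueP.++⁺ (uf (here refl))
  (concatMap-unique f u′ (uf ∘ there) (λ y∈ z∈ → det (there y∈) (there z∈)))
  λ (z∈fx , z∈rest) → let y , y∈xs , z∈fy = find (∈-concatMap⁻ f z∈rest) in
    UniqueP.Unique[x∷xs]⇒x∉xs u (subst (_∈ xs) (≡.sym (det (here refl) (there y∈xs) z∈fx z∈fy)) y∈xs)

vecsOf-unique : {X : Set} {xs : List X} → Unique xs → ∀ m → Unique (vecsOf xs m)
vecsOf-unique u zero    = [] ∷ []
vecsOf-unique {xs = xs} u (suc m) = concatMap-unique (λ x → map (x Vec.∷_) (vecsOf xs m)) u
  (λ _ → UniqueP.map⁺ (λ { refl → refl }) (vecsOf-unique u m))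
  (λ _ _ z∈x z∈y → same-head (∈-map⁻ _ z∈x) (∈-map⁻ _ z∈y))
  where
  same-head : ∀ {x y z} → ∃ (λ v → v ∈ vecsOf xs m × z ≡ x Vec.∷ v) →
    ∃ (λ v → v ∈ vecsOf xs m × z ≡ y Vec.∷ v) → x ≡ y
  same-head (_ , _ , refl) (_ , _ , refl) = refl

∈-vecsOf : {X : Set} {xs : List X} → (∀ x → x ∈ xs) → ∀ {m} (v : Vec X m) → v ∈ vecsOf xs m
∈-vecsOf all∈ Vec.[]      = here refl
∈-vecsOf all∈ (x Vec.∷ v) = ∈-concatMap⁺ _ (lose (all∈ x) (∈-map⁺ (x Vec.∷_) (∈-vecsOf all∈ v)))

unique⇒lookup-injective : {X : Set} {m : ℕ} (v : Vec X m) → Unique (Vec.toList v) →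
  ∀ {i j} → Vec.lookup v i ≡ Vec.lookup v j → i ≡ j
unique⇒lookup-injective v u {i} {j} = VecUniqueP.lookup-injective (fromList v u) i j
  where
  fromList : {X : Set} {m : ℕ} (v : Vec X m) → Unique (Vec.toList v) → VecUnique.Unique v
  fromList Vec.[]      []      = VecAllPairs.[]
  fromList (x Vec.∷ v) (p ∷ u) = VecAllP.toList⁻ p VecAllPairs.∷ fromList v u

lookup-injective⇒unique : {X : Set} {m : ℕ} (v : Vec X m) →
  (∀ {i j} → Vec.lookup v i ≡ Vec.lookup v j → i ≡ j) → Unique (Vec.toList v)
lookup-injective⇒unique Vec.[]      inj = []
lookup-injective⇒unique (x Vec.∷ v) inj =
  VecAllP.toList⁺ (VecAllP.lookup⁻ (λ i eq → FinP.0≢1+n (inj eq)))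
  ∷ lookup-injective⇒unique v (FinP.suc-injective ∘ inj)

lookup-≗ : {X : Set} {m : ℕ} (v w : Vec X m) → (∀ i → Vec.lookup v i ≡ Vec.lookup w i) → v ≡ w
lookup-≗ v w eq = ≡.trans (≡.sym (VecP.tabulate∘lookup v))
  (≡.trans (VecP.tabulate-cong eq) (VecP.tabulate∘lookup w))

-- Permutations with one cycle

-- An inductive path can be rewritten arrow by arrow when a symbol is spliced into a cycle or cut
-- out of it; the bounded iterates in `IsCycleMin` do not allow this directly.
data ReachesZero {n : ℕ} (f : Fun n) : Fin n → Set where
  stop : ∀ {x} → toℕ x ≡ 0 → ReachesZero f x
  next : ∀ {x} → ReachesZero f (f x) → ReachesZero f x

reachesZero-iter⁻ : ∀ {n} (f : Fun n) j {x} → ReachesZero f (iter f j x) → ReachesZero f x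
reachesZero-iter⁻ f zero    r = r
reachesZero-iter⁻ f (suc j) r = reachesZero-iter⁻ f j (next r)

iter-+ : ∀ {n} (f : Fun n) i j x → iter f (i + j) x ≡ iter f i (iter f j x)
iter-+ f zero    j x = refl
iter-+ f (suc i) j x = cong f (iter-+ f i j x)

reachesZero-iter : ∀ {n} (f : Fun n) {x} → ReachesZero f x → ∃ λ j → toℕ (iter f j x) ≡ 0
reachesZero-iter f (stop eq) = 0 , eq
reachesZero-iter f {x} (next r) with reachesZero-iter f r
... | j , eq = j + 1 , ≡.trans (cong toℕ (iter-+ f j 1 x)) eq

-- Two of the exponents 0, ..., n give the same iterate of x by the pigeonhole principle, so an
-- exponent j ≥ n can be lowered by their difference. It is needed because `IsCycleMin` inspects
-- only exponents below n.
iter-bounded : ∀ {n} (f : Fun n) x j → ∃ λ i → i < n × iter f j x ≡ iter f i x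
iter-bounded {n} f x = <-rec _ reduce
  where
  reduce : ∀ j → (∀ {j′} → j′ < j → ∃ λ i → i < n × iter f j′ x ≡ iter f i x) →
    ∃ λ i → i < n × iter f j x ≡ iter f i x
  reduce j rec with j ℕP.<? n
  ... | yes j<n = j , j<n , refl
  ... | no j≮n with FinP.pigeonhole (ℕP.n<1+n n) (λ i → iter f (toℕ i) x)
  ... | p , q , p<q , eq = let i , i<n , eq′ = rec shorter in i , i<n , ≡.trans same eq′
    where
    q≤j : toℕ q ≤ j
    q≤j = ℕP.≤-trans (ℕP.≤-pred (FinP.toℕ<n q)) (ℕP.≮⇒≥ j≮n)
    shorter : (j ∸ toℕ q) + toℕ p < j
    shorter = subst ((j ∸ toℕ q) + toℕ p <_) (ℕP.m∸n+n≡m q≤j) (ℕP.+-monoʳ-< (j ∸ toℕ q) p<q)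
    same : iter f j x ≡ iter f ((j ∸ toℕ q) + toℕ p) x
    same = begin
      iter f j x                             ≡⟨ cong (λ i → iter f i x) (ℕP.m∸n+n≡m q≤j) ⟨
      iter f ((j ∸ toℕ q) + toℕ q) x         ≡⟨ iter-+ f (j ∸ toℕ q) (toℕ q) x ⟩
      iter f (j ∸ toℕ q) (iter f (toℕ q) x)  ≡⟨ cong (iter f (j ∸ toℕ q)) eq ⟨
      iter f (j ∸ toℕ q) (iter f (toℕ p) x)  ≡⟨ iter-+ f (j ∸ toℕ q) (toℕ p) x ⟨
      iter f ((j ∸ toℕ q) + toℕ p) x         ∎
      where open ≡.≡-Reasoning

zero-isCycleMin : ∀ {k} (f : Fun (suc k)) → IsCycleMin f Fin.zero
zero-isCycleMin f = All.tabulate (λ _ → z≤n)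

cycles≥1 : ∀ {k} (f : Fun (suc k)) → 1 ≤ cycles f
cycles≥1 f = ∈-length (∈-filter⁺ (isCycleMin? f) (∈-allFin Fin.zero) (zero-isCycleMin f))

length≡1⇒≡ : {X : Set} {xs : List X} {x y : X} → length xs ≡ 1 → x ∈ xs → y ∈ xs → x ≡ y
length≡1⇒≡ {xs = _ ∷ []} _ (here refl) (here refl) = refl

-- Since 0 is always a cycle minimum, it is the only one here. Every other symbol therefore has a
-- smaller iterate, and strong induction on the symbol applies.
cycles≡1⇒reachesZero : ∀ {k} (f : Fun (suc k)) → cycles f ≡ 1 → ∀ x → ReachesZero f x
cycles≡1⇒reachesZero {k} f one x = <-rec (λ m → ∀ x → toℕ x ≡ m → ReachesZero f x) descend (toℕ x) x refl
  where
  descend : ∀ m → (∀ {m′} → m′ < m → ∀ x → toℕ x ≡ m′ → ReachesZero f x) →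
    ∀ x → toℕ x ≡ m → ReachesZero f x
  descend _ rec x refl with isCycleMin? f x
  ... | yes x-min = stop (cong toℕ (length≡1⇒≡ one
    (∈-filter⁺ (isCycleMin? f) (∈-allFin x) x-min)
    (∈-filter⁺ (isCycleMin? f) (∈-allFin Fin.zero) (zero-isCycleMin f))))
  ... | no ¬x-min with find (AllP.¬All⇒Any¬ (λ j → toℕ x ℕP.≤? toℕ (iter f j x)) (upTo (suc k)) ¬x-min)
  ... | j , _ , x≰ = reachesZero-iter⁻ f j (rec (ℕP.≰⇒> x≰) (iter f j x) refl)

reachesZero⇒cycles≡1 : ∀ {k} (f : Fun (suc k)) → (∀ x → ReachesZero f x) → cycles f ≡ 1
reachesZero⇒cycles≡1 {k} f reach = PermP.↭-length (unique-set⇒↭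
  (UniqueP.filter⁺ (isCycleMin? f) (UniqueP.allFin⁺ (suc k))) ([] ∷ []) to from)
  where
  to : ∀ {x} → x ∈ filter (isCycleMin? f) (allFin (suc k)) → x ∈ Fin.zero ∷ []
  to {x} x∈ with reachesZero-iter f (reach x)
  ... | j , eq with iter-bounded f x j
  ... | i , i<n , same = here (FinP.toℕ-injective (ℕP.n≤0⇒n≡0 (subst (toℕ x ≤_)
    (≡.trans (cong toℕ (≡.sym same)) eq)
    (All.lookup (proj₂ (∈-filter⁻ (isCycleMin? f) {xs = allFin (suc k)} x∈)) (∈-upTo⁺ i<n)))))
  from : ∀ {x} → x ∈ Fin.zero ∷ [] → x ∈ filter (isCycleMin? f) (allFin (suc k))
  from (here refl) = ∈-filter⁺ (isCycleMin? f) (∈-allFin Fin.zero) (zero-isCycleMin f)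

-- Growing a cycle by its largest symbol

-- For an injective map of a finite set, forward paths to 0 from all symbols below j mean that these
-- symbols form a single cycle.
record InitialCycle {n : ℕ} (j : ℕ) (f : Fun n) : Set where
  field
    injective : ∀ {x y} → f x ≡ f y → x ≡ y
    fixed     : ∀ {x} → j ≤ toℕ x → f x ≡ x
    reaches   : ∀ {x} → toℕ x < j → ReachesZero f x

  preserves : ∀ {x} → toℕ x < j → toℕ (f x) < j
  preserves {x} x<j with toℕ (f x) ℕP.<? j
  ... | yes fx<j = fx<j
  -- If f x is at least j, then f fixes f x, and injectivity gives f x = x, which is below j.
  ... | no fx≮j  = contradiction (subst (λ z → toℕ z < j)
    (≡.sym (injective (fixed (ℕP.≮⇒≥ fx≮j)))) x<j) fx≮j

≢-from-< : ∀ {n} {x y : Fin n} {j} → toℕ x < j → j ≤ toℕ y → x ≢ y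
≢-from-< x<j j≤y refl = ℕP.<⇒≱ x<j j≤y

-- Right multiplication by (a c) splices the fixed symbol c into the cycle immediately before a.
insert : ∀ {n j} {c a : Fin n} {f f′ : Fun n} → toℕ c ≡ j → toℕ a < j →
  InitialCycle j f′ → (∀ x → f x ≡ tr (a , c) (f′ x)) → InitialCycle (suc j) f
insert {n} {j} {c} {a} {f} {f′} c≡j a<j cyc f≗ = record
  { injective = λ {x} {y} eq → C.injective (tr-injective a c
      (≡.trans (≡.sym (f≗ x)) (≡.trans eq (f≗ y))))
  ; fixed = λ {x} j<x → ≡.trans (f≗ x) (≡.trans (cong (tr (a , c)) (C.fixed (ℕP.<⇒≤ j<x)))
      (tr-neq (≡.≢-sym (≢-from-< a<j (ℕP.<⇒≤ j<x))) (≡.≢-sym (≢-from-< (s≤s (ℕP.≤-reflexive c≡j)) j<x))))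
  ; reaches = reaches
  }
  where
  module C = InitialCycle cyc
  f-c : f c ≡ a
  f-c = ≡.trans (f≗ c) (≡.trans (cong (tr (a , c)) (C.fixed (ℕP.≤-reflexive (≡.sym c≡j)))) (tr-eqʳ a c))
  below : ∀ {x} → toℕ x < j → ReachesZero f′ x → ReachesZero f x
  below         x<j (stop eq) = stop eq
  below {x = x} x<j (next r)  with f′ x FinP.≟ a | below (C.preserves x<j) r
  -- The arrow x → a of `f′` becomes x → c → a, so the path gets two arrows in place of one.
  ... | yes f′x≡a | r′ = next (subst (ReachesZero f)
    (≡.sym (≡.trans (f≗ x) (≡.trans (cong (tr (a , c)) f′x≡a) (tr-eqˡ a c))))
    (next (subst (ReachesZero f) (≡.trans f′x≡a (≡.sym f-c)) r′)))
  ... | no f′x≢a  | r′ = next (subst (ReachesZero f)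
    (≡.sym (≡.trans (f≗ x) (tr-neq f′x≢a
      (≢-from-< (C.preserves x<j) (ℕP.≤-reflexive (≡.sym c≡j)))))) r′)
  reaches : ∀ {x} → toℕ x < suc j → ReachesZero f x
  reaches {x} x≤j with ℕP.m<1+n⇒m<n∨m≡n x≤j
  ... | inj₁ x<j = below x<j (C.reaches x<j)
  ... | inj₂ x≡j = next (subst (ReachesZero f)
    (≡.trans (≡.sym f-c) (cong f (FinP.toℕ-injective (≡.trans c≡j (≡.sym x≡j)))))
    (below a<j (C.reaches a<j)))

¬reachesZero-fixed : ∀ {n} {f : Fun n} {x c} → x ≡ c → f c ≡ c → toℕ c ≢ 0 → ¬ ReachesZero f x
¬reachesZero-fixed refl _  c≢0 (stop eq) = c≢0 eq
¬reachesZero-fixed refl fc c≢0 (next r)  = ¬reachesZero-fixed fc fc c≢0 r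

-- Otherwise f c = c, and a fixed symbol different from 0 has no path to 0. That c is different from
-- 0 is the reason for the shape `suc j`.
image-below : ∀ {n j} {c : Fin n} {f : Fun n} → toℕ c ≡ suc j → InitialCycle (2 + j) f →
  toℕ (f c) < suc j
image-below {c = c} {f} c≡j cyc with ℕP.m<1+n⇒m<n∨m≡n (C.preserves c<)
  where
  module C = InitialCycle cyc
  c< : toℕ c < _
  c< = s≤s (ℕP.≤-reflexive c≡j)
... | inj₁ fc<j = fc<j
... | inj₂ fc≡j = contradiction (InitialCycle.reaches cyc (s≤s (ℕP.≤-reflexive c≡j)))
  (¬reachesZero-fixed refl (FinP.toℕ-injective (≡.trans fc≡j (≡.sym c≡j)))
    (λ c≡0 → ℕP.1+n≢0 (≡.trans (≡.sym c≡j) c≡0)))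

-- This inverts `insert`: the symbol before which c was spliced is f c, and multiplying by (f c, c)
-- makes c a fixed point again.
delete : ∀ {n j} {c : Fin n} {f f′ : Fun n} → toℕ c ≡ suc j → InitialCycle (2 + j) f →
  (∀ x → f′ x ≡ tr (f c , c) (f x)) → InitialCycle (suc j) f′
delete {n} {j} {c} {f} {f′} c≡j cyc f′≗ = record
  { injective = λ {x} {y} eq → C.injective (tr-injective (f c) c
      (≡.trans (≡.sym (f′≗ x)) (≡.trans eq (f′≗ y))))
  ; fixed = fixed
  ; reaches = λ x<j → below x<j (C.reaches (ℕP.m<n⇒m<1+n x<j))
  }
  where
  module C = InitialCycle cyc
  fc<j : toℕ (f c) < suc j
  fc<j = image-below c≡j cyc
  fixed : ∀ {x} → suc j ≤ toℕ x → f′ x ≡ x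
  fixed {x} j≤x with ℕP.m≤n⇒m<n∨m≡n j≤x
  ... | inj₁ j<x = ≡.trans (f′≗ x) (≡.trans (cong (tr (f c , c)) (C.fixed j<x))
    (tr-neq (≡.≢-sym (≢-from-< fc<j j≤x)) (≡.≢-sym (≢-from-< (s≤s (ℕP.≤-reflexive c≡j)) j<x))))
  ... | inj₂ j≡x with FinP.toℕ-injective (≡.trans c≡j j≡x)
  ... | refl = ≡.trans (f′≗ c) (tr-eqˡ (f c) c)
  below : ∀ {x} → toℕ x < suc j → ReachesZero f x → ReachesZero f′ x
  below         x<j (stop eq) = stop eq
  below {x = x} x<j (next r)  with f x FinP.≟ c
  ... | no fx≢c = next (subst (ReachesZero f′)
    (≡.sym (≡.trans (f′≗ x) (tr-neq (λ fx≡fc → ≢-from-< x<j (ℕP.≤-reflexive (≡.sym c≡j)) (C.injective fx≡fc)) fx≢c)))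
    (below (ℕP.≤∧≢⇒< (ℕP.≤-pred (C.preserves (ℕP.m<n⇒m<1+n x<j)))
      (λ eq → fx≢c (FinP.toℕ-injective (≡.trans eq (≡.sym c≡j))))) r))
  -- The arrows x → c → f c contract to x → f c; the path cannot end at c because c is not 0.
  ... | yes fx≡c with r
  ... | stop fx≡0 = contradiction (≡.trans (≡.sym c≡j) (≡.trans (cong toℕ (≡.sym fx≡c)) fx≡0)) ℕP.1+n≢0
  ... | next r′ = next (subst (ReachesZero f′)
    (≡.trans (cong f fx≡c) (≡.sym (≡.trans (f′≗ x) (≡.trans (cong (tr (f c , c)) fx≡c) (tr-eqʳ (f c) c)))))
    (below (subst (λ z → toℕ (f z) < suc j) (≡.sym fx≡c) fc<j) r′))

initialCycle-1 : ∀ {n} (v : PermVec n) → InitialCycle 1 (Vec.lookup v) → v ≡ Vec.tabulate id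
initialCycle-1 v cyc = ≡.trans (≡.sym (VecP.tabulate∘lookup v)) (VecP.tabulate-cong identity)
  where
  identity : ∀ x → Vec.lookup v x ≡ x
  identity x with toℕ x ℕP.<? 1
  ... | yes x<1 = FinP.toℕ-injective
    (≡.trans (ℕP.n<1⇒n≡0 (InitialCycle.preserves cyc x<1)) (≡.sym (ℕP.n<1⇒n≡0 x<1)))
  ... | no x≮1  = InitialCycle.fixed cyc (ℕP.≮⇒≥ x≮1)

initialCycle-id : ∀ {n} → InitialCycle {n} 1 (Vec.lookup (Vec.tabulate id))
initialCycle-id = record
  { injective = λ {x} {y} eq → ≡.trans (≡.sym (lookup-id x)) (≡.trans eq (lookup-id y))
  ; fixed     = λ {x} _ → lookup-id x
  ; reaches   = λ x<1 → stop (ℕP.n<1⇒n≡0 x<1)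
  }
  where
  lookup-id : ∀ {n} (x : Fin n) → Vec.lookup (Vec.tabulate id) x ≡ x
  lookup-id = VecP.lookup∘tabulate id

-- A list of all full cycles

insertions : ∀ {n} → Fin n → List (Fin n) → PermVec n → List (PermVec n)
insertions c U v = map (λ a → Vec.map (tr (a , c)) v) U

-- These are the products of transpositions obtained by expanding J_2 J_3 ⋯; the recursion copies
-- that of `E`. A single symbol has no predecessor to be spliced before, hence the separate clause.
initialCycles : ∀ {n} → List (Fin n) → List (PermVec n)
initialCycles []              = Vec.tabulate id ∷ []
initialCycles (c ∷ [])        = Vec.tabulate id ∷ []
initialCycles (c ∷ U@(_ ∷ _)) = concatMap (insertions c U) (initialCycles U)

∈-initialCycles⁻ : ∀ {n} {c : Fin n} {U v} → Initial (c ∷ U) → v ∈ initialCycles (c ∷ U) →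
  InitialCycle (suc (length U)) (Vec.lookup v)
∈-initialCycles⁻ {U = []}    i (here refl) = initialCycle-id
∈-initialCycles⁻ {c = c} {U@(_ ∷ _)} (c≡ ∷ i) v∈ with find (∈-concatMap⁻ (insertions c U) {xs = initialCycles U} v∈)
... | v′ , v′∈ , v∈ins with ∈-map⁻ _ v∈ins
... | a , a∈U , refl = insert c≡ (initial-< i a∈U) (∈-initialCycles⁻ i v′∈)
  (λ x → VecP.lookup-map x (tr (a , c)) v′)

∈-initialCycles⁺ : ∀ {n} {c : Fin n} {U} v → Initial (c ∷ U) →
  InitialCycle (suc (length U)) (Vec.lookup v) → v ∈ initialCycles (c ∷ U)
∈-initialCycles⁺ {U = []} v i cyc = here (initialCycle-1 v cyc)
∈-initialCycles⁺ {c = c} {U@(_ ∷ _)} v (c≡ ∷ i) cyc = ∈-concatMap⁺ (insertions c U)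
  (lose v′∈ (subst (_∈ insertions c U v′) v′-inserted (∈-map⁺ _ (initial-∈ i (image-below c≡ cyc)))))
  where
  -- A spliced cycle sends c to the symbol before which c was put, so that symbol is read off as the
  -- image of c.
  d : Fin _
  d = Vec.lookup v c
  v′ : PermVec _
  v′ = Vec.map (tr (d , c)) v
  v′∈ : v′ ∈ initialCycles U
  v′∈ = ∈-initialCycles⁺ v′ i (delete c≡ cyc (λ x → VecP.lookup-map x (tr (d , c)) v))
  v′-inserted : Vec.map (tr (d , c)) v′ ≡ v
  v′-inserted = lookup-≗ _ v (λ x → ≡.trans (VecP.lookup-map x (tr (d , c)) v′)
    (≡.trans (cong (tr (d , c)) (VecP.lookup-map x (tr (d , c)) v)) (tr-involutive d c (Vec.lookup v x))))

-- The smaller cycle fixes c, so the value of the spliced cycle at c reveals a; cancelling (a c)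
-- then reveals the smaller cycle.
initialCycles-unique : ∀ {n} {U : List (Fin n)} → Initial U → Unique (initialCycles U)
initialCycles-unique {U = []}             i        = [] ∷ []
initialCycles-unique {U = c ∷ []}         i        = [] ∷ []
initialCycles-unique {U = c ∷ U@(_ ∷ _)} (c≡ ∷ i) =
  concatMap-unique (insertions c U) (initialCycles-unique i)
    (λ {v} v∈ → UniqueP.map⁺ (λ {a} {b} eq → ≡.trans (≡.sym (at-c a v∈))
      (≡.trans (cong (λ w → Vec.lookup w c) eq) (at-c b v∈))) (initial-unique i))
    (λ v∈ w∈ z∈v z∈w → same v∈ w∈ (∈-map⁻ _ z∈v) (∈-map⁻ _ z∈w))
  where
  at-c : ∀ {v} a → v ∈ initialCycles U → Vec.lookup (Vec.map (tr (a , c)) v) c ≡ a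
  at-c {v} a v∈ = ≡.trans (VecP.lookup-map c (tr (a , c)) v)
    (≡.trans (cong (tr (a , c)) (InitialCycle.fixed (∈-initialCycles⁻ i v∈)
      (ℕP.≤-reflexive (≡.sym c≡)))) (tr-eqʳ a c))
  same : ∀ {v w z} → v ∈ initialCycles U → w ∈ initialCycles U →
    ∃ (λ a → a ∈ U × z ≡ Vec.map (tr (a , c)) v) →
    ∃ (λ b → b ∈ U × z ≡ Vec.map (tr (b , c)) w) → v ≡ w
  same {v} {w} v∈ w∈ (a , _ , refl) (b , _ , eq)
    with ≡.trans (≡.sym (at-c a v∈)) (≡.trans (cong (λ z → Vec.lookup z c) eq) (at-c b w∈))
  ... | refl = lookup-≗ v w (λ x → tr-injective a c
    (≡.trans (≡.sym (VecP.lookup-map x (tr (a , c)) v))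
      (≡.trans (cong (λ z → Vec.lookup z x) eq) (VecP.lookup-map x (tr (a , c)) w))))

isFullCycle? : ∀ {n} (v : PermVec n) → Dec (cycles (Vec.lookup v) ≡ 1)
isFullCycle? v = cycles (Vec.lookup v) ℕP.≟ 1

fullCycles-↭ : ∀ {n} {c : Fin n} {U} → Initial (c ∷ U) → length (c ∷ U) ≡ n →
  filter isFullCycle? (allPerms n) ↭ initialCycles (c ∷ U)
fullCycles-↭ {suc k} {c} {V} i len = unique-set⇒↭
  (UniqueP.filter⁺ isFullCycle? (UniqueP.filter⁺ isPermVec? (vecsOf-unique (UniqueP.allFin⁺ (suc k)) (suc k))))
  (initialCycles-unique i) to from
  where
  U : List (Fin (suc k))
  U = c ∷ V
  to : ∀ {v} → v ∈ filter isFullCycle? (allPerms (suc k)) → v ∈ initialCycles U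
  to {v} v∈ = let v∈perms , one = ∈-filter⁻ isFullCycle? {xs = allPerms (suc k)} v∈ in
    ∈-initialCycles⁺ v i (subst (λ j → InitialCycle j (Vec.lookup v)) (≡.sym len) record
      { injective = unique⇒lookup-injective v
          (proj₂ (∈-filter⁻ isPermVec? {xs = vecsOf (allFin (suc k)) (suc k)} v∈perms))
      ; fixed     = λ {x} n≤x → contradiction (FinP.toℕ<n x) (ℕP.≤⇒≯ n≤x)
      ; reaches   = λ {x} _ → cycles≡1⇒reachesZero (Vec.lookup v) one x
      })
  from : ∀ {v} → v ∈ initialCycles U → v ∈ filter isFullCycle? (allPerms (suc k))
  from {v} v∈ = let module C = InitialCycle (subst (λ j → InitialCycle j (Vec.lookup v)) len (∈-initialCycles⁻ i v∈)) in
    ∈-filter⁺ isFullCycle?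
      (∈-filter⁺ isPermVec? (∈-vecsOf ∈-allFin v) (lookup-injective⇒unique v C.injective))
      (reachesZero⇒cycles≡1 (Vec.lookup v) (λ x → C.reaches (FinP.toℕ<n x)))

-- Semirings with formal transpositions

-- The group-algebra argument rests on the relations `t-square` and `t-conj` and on additive
-- cancellation, so it is carried out over any semiring that has them; maps and counting appear only
-- in the instance.
module Star {n : ℕ} (R : Semiring 0ℓ 0ℓ)
  (cancelʳ : AlgDefs.RightCancellative (Semiring._≈_ R) (Semiring._+_ R))
  (t : Fin n → Fin n → Semiring.Carrier R)
  (t-square : (a b : Fin n) → Semiring._≈_ R (Semiring._*_ R (t a b) (t a b)) (Semiring.1# R))
  (t-conj : (a b c d : Fin n) → Semiring._≈_ R (Semiring._*_ R (t a b) (t c d))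
    (Semiring._*_ R (t (tr (a , b) c) (tr (a , b) d)) (t a b)))
  where

  open Semiring R hiding (zero) renaming (_+_ to _⊕_; _*_ to _⊛_; refl to ≈-refl; sym to ≈-sym; trans to ≈-trans)
  open SetoidReasoning setoid
  open CommutativeSemigroupP +-commutativeSemigroup using () renaming (interchange to ⊕-interchange)

  ∑ : {X : Set} → List X → (X → Carrier) → Carrier
  ∑ []       f = 0#
  ∑ (x ∷ xs) f = f x ⊕ ∑ xs f

  when : Bool → Carrier → Carrier
  when true  x = x
  when false x = 0#

  ∑-cong : {X : Set} (xs : List X) {f g : X → Carrier} →
    (∀ x → x ∈ xs → f x ≈ g x) → ∑ xs f ≈ ∑ xs g
  ∑-cong []       eq = ≈-refl
  ∑-cong (x ∷ xs) eq = +-cong (eq x (here refl)) (∑-cong xs (λ y → eq y ∘ there))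

  ∑-map : {X Y : Set} (h : X → Y) (xs : List X) (f : Y → Carrier) →
    ∑ (map h xs) f ≈ ∑ xs (f ∘ h)
  ∑-map h []       f = ≈-refl
  ∑-map h (x ∷ xs) f = +-congˡ (∑-map h xs f)

  ∑-++ : {X : Set} (xs ys : List X) (f : X → Carrier) → ∑ (xs ++ ys) f ≈ ∑ xs f ⊕ ∑ ys f
  ∑-++ []       ys f = ≈-sym (+-identityˡ _)
  ∑-++ (x ∷ xs) ys f = ≈-trans (+-congˡ (∑-++ xs ys f)) (≈-sym (+-assoc _ _ _))

  ∑-concatMap : {X Y : Set} (h : X → List Y) (xs : List X) (f : Y → Carrier) →
    ∑ (concatMap h xs) f ≈ ∑ xs (λ x → ∑ (h x) f)
  ∑-concatMap h []       f = ≈-refl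
  ∑-concatMap h (x ∷ xs) f =
    ≈-trans (∑-++ (h x) (concatMap h xs) f) (+-congˡ (∑-concatMap h xs f))

  ∑-0 : {X : Set} (xs : List X) → ∑ xs (λ _ → 0#) ≈ 0#
  ∑-0 []       = ≈-refl
  ∑-0 (x ∷ xs) = ≈-trans (+-identityˡ _) (∑-0 xs)

  ∑-⊕ : {X : Set} (xs : List X) (f g : X → Carrier) →
    ∑ xs (λ x → f x ⊕ g x) ≈ ∑ xs f ⊕ ∑ xs g
  ∑-⊕ []       f g = ≈-sym (+-identityˡ _)
  ∑-⊕ (x ∷ xs) f g = ≈-trans (+-congˡ (∑-⊕ xs f g)) (⊕-interchange _ _ _ _)

  ∑-distribˡ : {X : Set} (xs : List X) (z : Carrier) (f : X → Carrier) →
    z ⊛ ∑ xs f ≈ ∑ xs (λ x → z ⊛ f x)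
  ∑-distribˡ []       z f = zeroʳ z
  ∑-distribˡ (x ∷ xs) z f = ≈-trans (distribˡ _ _ _) (+-congˡ (∑-distribˡ xs z f))

  ∑-distribʳ : {X : Set} (xs : List X) (z : Carrier) (f : X → Carrier) →
    ∑ xs f ⊛ z ≈ ∑ xs (λ x → f x ⊛ z)
  ∑-distribʳ []       z f = zeroˡ z
  ∑-distribʳ (x ∷ xs) z f = ≈-trans (distribʳ _ _ _) (+-congˡ (∑-distribʳ xs z f))

  ∑-swap : {X Y : Set} (xs : List X) (ys : List Y) (f : X → Y → Carrier) →
    ∑ xs (λ x → ∑ ys (f x)) ≈ ∑ ys (λ y → ∑ xs (λ x → f x y))
  ∑-swap []       ys f = ≈-sym (∑-0 ys)
  ∑-swap (x ∷ xs) ys f = ≈-trans (+-congˡ (∑-swap xs ys f)) (≈-sym (∑-⊕ ys _ _))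

  ∑-↭ : {X : Set} {xs ys : List X} (f : X → Carrier) → xs ↭ ys → ∑ xs f ≈ ∑ ys f
  ∑-↭ f refl         = ≈-refl
  ∑-↭ f (prep x p)   = +-congˡ (∑-↭ f p)
  ∑-↭ f (swap x y p) = ≈-trans (≈-sym (+-assoc _ _ _))
    (≈-trans (+-cong (+-comm _ _) (∑-↭ f p)) (+-assoc _ _ _))
  ∑-↭ f (trans p q)  = ≈-trans (∑-↭ f p) (∑-↭ f q)

  ∑-filter : {X : Set} {P : X → Set} (P? : ∀ x → Dec (P x)) (xs : List X) (f : X → Carrier) →
    ∑ (filter P? xs) f ≈ ∑ xs (λ x → when (does (P? x)) (f x))
  ∑-filter P? []       f = ≈-refl
  ∑-filter P? (x ∷ xs) f with does (P? x)
  ... | true  = +-congˡ (∑-filter P? xs f)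
  ... | false = ≈-trans (∑-filter P? xs f) (≈-sym (+-identityˡ _))

  when-⊛ : ∀ b z x → when b (z ⊛ x) ≈ z ⊛ when b x
  when-⊛ true  z x = ≈-refl
  when-⊛ false z x = ≈-sym (zeroʳ z)

  when-⊛ˡ : ∀ b x z → when b (x ⊛ z) ≈ when b x ⊛ z
  when-⊛ˡ true  x z = ≈-refl
  when-⊛ˡ false x z = ≈-sym (zeroˡ z)

  when-cong : ∀ b {x y} → x ≈ y → when b x ≈ when b y
  when-cong true  eq = eq
  when-cong false eq = ≈-refl

  when-∧ : ∀ b c x → when (b ∧ c) x ≈ when b (when c x)
  when-∧ true  c x = ≈-refl
  when-∧ false c x = ≈-refl

  when-∑ : {X : Set} (b : Bool) (xs : List X) (f : X → Carrier) →
    when b (∑ xs f) ≈ ∑ xs (λ x → when b (f x))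
  when-∑ true  xs f = ≈-refl
  when-∑ false xs f = ≈-sym (∑-0 xs)

  -- Commutation and conjugation

  Commute : Carrier → Carrier → Set
  Commute x y = x ⊛ y ≈ y ⊛ x

  commute-⊕ : ∀ {z x y} → Commute z x → Commute z y → Commute z (x ⊕ y)
  commute-⊕ p q = ≈-trans (distribˡ _ _ _) (≈-trans (+-cong p q) (≈-sym (distribʳ _ _ _)))

  commute-⊛ : ∀ {z x y} → Commute z x → Commute z y → Commute z (x ⊛ y)
  commute-⊛ {z} {x} {y} p q = begin
    z ⊛ (x ⊛ y)  ≈⟨ *-assoc z x y ⟨
    (z ⊛ x) ⊛ y  ≈⟨ *-congʳ p ⟩
    (x ⊛ z) ⊛ y  ≈⟨ *-assoc x z y ⟩
    x ⊛ (z ⊛ y)  ≈⟨ *-congˡ q ⟩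
    x ⊛ (y ⊛ z)  ≈⟨ *-assoc x y z ⟨
    (x ⊛ y) ⊛ z  ∎

  -- This replaces the argument that w - y commutes with z because w and y do.
  commute-cancel : ∀ {z x y w} → x ⊕ y ≈ w → Commute z y → Commute z w → Commute z x
  commute-cancel {z} {x} {y} {w} eq zy zw = cancelʳ (z ⊛ y) (z ⊛ x) (x ⊛ z) (begin
    (z ⊛ x) ⊕ (z ⊛ y)  ≈⟨ distribˡ z x y ⟨
    z ⊛ (x ⊕ y)        ≈⟨ *-congˡ eq ⟩
    z ⊛ w              ≈⟨ zw ⟩
    w ⊛ z              ≈⟨ *-congʳ eq ⟨
    (x ⊕ y) ⊛ z        ≈⟨ distribʳ z x y ⟩
    (x ⊛ z) ⊕ (y ⊛ z)  ≈⟨ +-congˡ zy ⟨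
    (x ⊛ z) ⊕ (z ⊛ y)  ∎)

  -- In generating functions, step P x = P · x / (1 − T x).
  step : (ℕ → Carrier) → Carrier → ℕ → Carrier
  step P x zero    = P zero ⊛ x
  step P x (suc m) = (step P x m ⊕ P (suc m)) ⊛ x

  step-cong : ∀ {P Q x y} → (∀ m → P m ≈ Q m) → x ≈ y → ∀ m → step P x m ≈ step Q y m
  step-cong p q zero    = *-cong (p zero) q
  step-cong p q (suc m) = *-cong (+-cong (step-cong p q m) (p (suc m))) q

  conj-⊛ : ∀ {z x x′ y y′} → z ⊛ x ≈ x′ ⊛ z → z ⊛ y ≈ y′ ⊛ z →
    z ⊛ (x ⊛ y) ≈ (x′ ⊛ y′) ⊛ z
  conj-⊛ {z} {x} {x′} {y} {y′} p q = begin
    z ⊛ (x ⊛ y)    ≈⟨ *-assoc z x y ⟨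
    (z ⊛ x) ⊛ y    ≈⟨ *-congʳ p ⟩
    (x′ ⊛ z) ⊛ y   ≈⟨ *-assoc x′ z y ⟩
    x′ ⊛ (z ⊛ y)   ≈⟨ *-congˡ q ⟩
    x′ ⊛ (y′ ⊛ z)  ≈⟨ *-assoc x′ y′ z ⟨
    (x′ ⊛ y′) ⊛ z  ∎

  conj-⊕ : ∀ {z x x′ y y′} → z ⊛ x ≈ x′ ⊛ z → z ⊛ y ≈ y′ ⊛ z →
    z ⊛ (x ⊕ y) ≈ (x′ ⊕ y′) ⊛ z
  conj-⊕ p q = ≈-trans (distribˡ _ _ _) (≈-trans (+-cong p q) (≈-sym (distribʳ _ _ _)))

  -- Stated for conjugation, it serves relabelling in `A-conj` and, with `P′` = P and `x′` = x,
  -- commutation in `centralises-A`.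
  step-conj : ∀ {z P P′ x x′} → (∀ m → z ⊛ P m ≈ P′ m ⊛ z) → z ⊛ x ≈ x′ ⊛ z →
    ∀ m → z ⊛ step P x m ≈ step P′ x′ m ⊛ z
  step-conj p q zero    = conj-⊛ (p zero) q
  step-conj p q (suc m) = conj-⊛ (conj-⊕ (step-conj p q m) (p (suc m))) q

  -- The coefficients of P · xy / ((1 − T x)(1 − T y)) satisfy a recurrence
  -- whose coefficients are the symmetric functions x + y and xy.
  module TwoSteps {P : ℕ → Carrier} {x y s : Carrier} (xy≈yx : Commute x y)
    (s-P : ∀ m → Commute s (P m)) (s-sum : Commute s (x ⊕ y)) (s-prod : Commute s (x ⊛ y)) where

    Q W : ℕ → Carrier
    Q = step P x
    W = step Q y

    -- Here w stands for W m, and v for x times the preceding coefficient of W, with 0 in place of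
    -- the latter when m = 0. Keeping v free lets one computation give both `recurrence₁` and
    -- `recurrence₂`.
    lemma-Wx : ∀ {v w} m → w ⊛ x ≈ (v ⊕ Q m ⊛ x) ⊛ y →
      w ⊛ (x ⊕ y) ⊕ P (suc m) ⊛ (x ⊛ y) ≈ (w ⊕ Q (suc m)) ⊛ y ⊕ v ⊛ y
    lemma-Wx {v} {w} m eq = begin
      w ⊛ (x ⊕ y) ⊕ P (suc m) ⊛ (x ⊛ y)
        ≈⟨ +-cong (distribˡ w x y) (≈-sym (*-assoc _ _ _)) ⟩
      (w ⊛ x ⊕ w ⊛ y) ⊕ (P (suc m) ⊛ x) ⊛ y
        ≈⟨ +-congʳ (+-congʳ (≈-trans eq (distribʳ _ _ _))) ⟩
      ((v ⊛ y ⊕ (Q m ⊛ x) ⊛ y) ⊕ w ⊛ y) ⊕ (P (suc m) ⊛ x) ⊛ y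
        ≈⟨ +-congʳ (+-congʳ (+-comm _ _)) ⟩
      (((Q m ⊛ x) ⊛ y ⊕ v ⊛ y) ⊕ w ⊛ y) ⊕ (P (suc m) ⊛ x) ⊛ y
        ≈⟨ +-congʳ (+-assoc _ _ _) ⟩
      ((Q m ⊛ x) ⊛ y ⊕ (v ⊛ y ⊕ w ⊛ y)) ⊕ (P (suc m) ⊛ x) ⊛ y
        ≈⟨ +-comm _ _ ⟩
      (P (suc m) ⊛ x) ⊛ y ⊕ ((Q m ⊛ x) ⊛ y ⊕ (v ⊛ y ⊕ w ⊛ y))
        ≈⟨ +-assoc _ _ _ ⟨
      ((P (suc m) ⊛ x) ⊛ y ⊕ (Q m ⊛ x) ⊛ y) ⊕ (v ⊛ y ⊕ w ⊛ y)
        ≈⟨ +-cong (≈-trans (+-comm _ _) (≈-sym (distribʳ _ _ _))) (+-comm _ _) ⟩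
      ((Q m ⊛ x) ⊕ (P (suc m) ⊛ x)) ⊛ y ⊕ (w ⊛ y ⊕ v ⊛ y)
        ≈⟨ +-congʳ (*-congʳ (distribʳ _ _ _)) ⟨
      Q (suc m) ⊛ y ⊕ (w ⊛ y ⊕ v ⊛ y)
        ≈⟨ +-assoc _ _ _ ⟨
      (Q (suc m) ⊛ y ⊕ w ⊛ y) ⊕ v ⊛ y
        ≈⟨ +-congʳ (≈-trans (+-comm _ _) (≈-sym (distribʳ _ _ _))) ⟩
      (w ⊕ Q (suc m)) ⊛ y ⊕ v ⊛ y ∎

    swap-yx : ∀ u → (u ⊛ y) ⊛ x ≈ (u ⊛ x) ⊛ y
    swap-yx u = begin
      (u ⊛ y) ⊛ x  ≈⟨ *-assoc u y x ⟩
      u ⊛ (y ⊛ x)  ≈⟨ *-congˡ xy≈yx ⟨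
      u ⊛ (x ⊛ y)  ≈⟨ *-assoc u x y ⟨
      (u ⊛ x) ⊛ y  ∎

    recurrence₁ : W 1 ≈ W 0 ⊛ (x ⊕ y) ⊕ P 1 ⊛ (x ⊛ y)
    recurrence₁ = ≈-sym (≈-trans
      (lemma-Wx 0 (≈-trans (swap-yx (Q 0)) (*-congʳ (≈-sym (+-identityˡ _)))))
      (≈-trans (+-congˡ (zeroˡ y)) (+-identityʳ _)))

    recurrence₂ : ∀ m →
      W (2 + m) ⊕ W m ⊛ (x ⊛ y) ≈ W (1 + m) ⊛ (x ⊕ y) ⊕ P (2 + m) ⊛ (x ⊛ y)
    recurrence₂ m = ≈-sym (≈-trans
      (lemma-Wx (suc m) (≈-trans (swap-yx _) (*-congʳ (distribʳ _ _ _))))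
      (+-congˡ (*-assoc _ _ _)))

    commutes : ∀ m → Commute s (W m)
    commutes zero = ≈-trans (*-congˡ (*-assoc _ _ _))
      (≈-trans (commute-⊛ (s-P 0) s-prod) (*-congʳ (≈-sym (*-assoc _ _ _))))
    commutes (suc zero) = ≈-trans (*-congˡ recurrence₁)
      (≈-trans (commute-⊕ (commute-⊛ (commutes zero) s-sum) (commute-⊛ (s-P 1) s-prod))
               (*-congʳ (≈-sym recurrence₁)))
    -- The term W m xy stands on the same side as W (2 + m); it commutes with s by induction and is
    -- cancelled.
    commutes (suc (suc m)) = commute-cancel (recurrence₂ m)
      (commute-⊛ (commutes m) s-prod)
      (commute-⊕ (commute-⊛ (commutes (suc m)) s-sum) (commute-⊛ (s-P (2 + m)) s-prod))

  -- Jucys-Murphy elements and independence of the order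

  -- For U = {1, …, c − 1} this is the Jucys–Murphy element of c.
  J : Fin n → List (Fin n) → Carrier
  J c U = ∑ U (λ a → t a c)

  -- Coefficients of the constant series 1: with at most one symbol only the empty word contributes.
  δ : ℕ → Carrier
  δ zero    = 1#
  δ (suc m) = 0#

  -- Singletons are separate because J c [] = 0.
  A : List (Fin n) → ℕ → Carrier
  A []              = δ
  A (c ∷ [])        = δ
  A (c ∷ U@(_ ∷ _)) = step (A U) (J c U)

  J-conj : ∀ a b c U → t a b ⊛ J c U ≈ J (tr (a , b) c) (map (tr (a , b)) U) ⊛ t a b
  J-conj a b c U = begin
    t a b ⊛ J c U                                    ≈⟨ ∑-distribˡ U _ _ ⟩
    ∑ U (λ d → t a b ⊛ t d c)                        ≈⟨ ∑-cong U (λ d _ → t-conj a b d c) ⟩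
    ∑ U (λ d → t (τ d) (τ c) ⊛ t a b)                ≈⟨ ∑-distribʳ U _ _ ⟨
    ∑ U (λ d → t (τ d) (τ c)) ⊛ t a b                ≈⟨ *-congʳ (∑-map τ U _) ⟨
    J (τ c) (map τ U) ⊛ t a b                        ∎
    where
    τ : Fin n → Fin n
    τ = tr (a , b)

  δ-central : ∀ z m → Commute z (δ m)
  δ-central z zero    = ≈-trans (*-identityʳ z) (≈-sym (*-identityˡ z))
  δ-central z (suc m) = ≈-trans (zeroʳ z) (≈-sym (zeroˡ z))

  A-conj : ∀ a b U m → t a b ⊛ A U m ≈ A (map (tr (a , b)) U) m ⊛ t a b
  A-conj a b []              = δ-central _
  A-conj a b (c ∷ [])        = δ-central _
  A-conj a b (c ∷ U@(_ ∷ _)) = step-conj (A-conj a b U) (J-conj a b c U)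

  Centralises : Carrier → List (Fin n) → Set
  Centralises z U = ∀ a b → a ∈ U → b ∈ U → Commute z (t a b)

  centralises-tail : ∀ {z c U} → Centralises z (c ∷ U) → Centralises z U
  centralises-tail h a b a∈U b∈U = h a b (there a∈U) (there b∈U)

  centralises-J : ∀ {z c U} → Centralises z (c ∷ U) → Commute z (J c U)
  centralises-J {z} {c} {U} h = ≈-trans (∑-distribˡ U _ _)
    (≈-trans (∑-cong U (λ a a∈U → h a c (there a∈U) (here refl))) (≈-sym (∑-distribʳ U _ _)))

  centralises-A : ∀ {z} U → Centralises z U → ∀ m → Commute z (A U m)
  centralises-A []              h = δ-central _
  centralises-A (c ∷ [])        h = δ-central _
  centralises-A (c ∷ U@(_ ∷ _)) h =
    step-conj (centralises-A U (centralises-tail h)) (centralises-J h)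

  -- Conjugation by (a b) with a and b in U fixes c and only permutes the summands. In particular,
  -- `J c U` commutes with all elements formed from U.
  J-centralises : ∀ {c U} → Unique (c ∷ U) → Centralises (J c U) U
  J-centralises {c} {U} u@(c∉U ∷ uU) a b a∈U b∈U = ≈-sym (begin
    t a b ⊛ J c U                                  ≈⟨ J-conj a b c U ⟩
    J (tr (a , b) c) (map (tr (a , b)) U) ⊛ t a b  ≡⟨ cong (λ d → J d (map (tr (a , b)) U) ⊛ t a b) (tr-neq (c≢ a∈U) (c≢ b∈U)) ⟩
    J c (map (tr (a , b)) U) ⊛ t a b               ≈⟨ *-congʳ (∑-↭ _ (map-tr-↭ uU a∈U b∈U)) ⟩
    J c U ⊛ t a b                                  ∎)
    where
    c≢ : ∀ {x} → x ∈ U → c ≢ x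
    c≢ x∈U = All.lookup c∉U x∈U

  -- Writing y = s + y₀ with s x = y₀ s gives s y = 1 + x s and y s = 1 + s x, the relations of the
  -- degenerate affine Hecke algebra. From these, s commutes with x + y and xy.
  module Exchange {c d : Fin n} {U : List (Fin n)} (u : Unique (d ∷ c ∷ U)) where

    s x y y₀ : Carrier
    s  = t c d
    x  = J c U
    y₀ = J d U
    y  = J d (c ∷ U)

    c∉U : c ∉ U
    c∉U = UniqueP.Unique[x∷xs]⇒x∉xs (AllPairs.tail u)

    d∉U : d ∉ U
    d∉U = UniqueP.Unique[x∷xs]⇒x∉xs u ∘ there

    s-x : s ⊛ x ≈ y₀ ⊛ s
    s-x = ≈-trans (J-conj c d c U) (*-congʳ (reflexive
      (cong₂ J (tr-eqˡ c d) (map-tr-fixed c∉U d∉U))))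

    s-y₀ : s ⊛ y₀ ≈ x ⊛ s
    s-y₀ = ≈-trans (J-conj c d d U) (*-congʳ (reflexive
      (cong₂ J (tr-eqʳ c d) (map-tr-fixed c∉U d∉U))))

    s-y : s ⊛ y ≈ 1# ⊕ x ⊛ s
    s-y = ≈-trans (distribˡ _ _ _) (+-cong (t-square c d) s-y₀)

    y-s : y ⊛ s ≈ 1# ⊕ s ⊛ x
    y-s = ≈-trans (distribʳ _ _ _) (+-cong (t-square c d) (≈-sym s-x))

    xy≈yx : Commute x y
    xy≈yx = ≈-sym (centralises-J (J-centralises u))

    s-sum : Commute s (x ⊕ y)
    s-sum = begin
      s ⊛ (x ⊕ y)             ≈⟨ distribˡ _ _ _ ⟩
      s ⊛ x ⊕ s ⊛ y           ≈⟨ +-congˡ s-y ⟩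
      s ⊛ x ⊕ (1# ⊕ x ⊛ s)    ≈⟨ +-assoc _ _ _ ⟨
      (s ⊛ x ⊕ 1#) ⊕ x ⊛ s    ≈⟨ +-comm _ _ ⟩
      x ⊛ s ⊕ (s ⊛ x ⊕ 1#)    ≈⟨ +-congˡ (+-comm _ _) ⟩
      x ⊛ s ⊕ (1# ⊕ s ⊛ x)    ≈⟨ +-congˡ y-s ⟨
      x ⊛ s ⊕ y ⊛ s           ≈⟨ distribʳ _ _ _ ⟨
      (x ⊕ y) ⊛ s             ∎

    s-prod : Commute s (x ⊛ y)
    s-prod = begin
      s ⊛ (x ⊛ y)        ≈⟨ *-congˡ xy≈yx ⟩
      s ⊛ (y ⊛ x)        ≈⟨ *-assoc _ _ _ ⟨
      (s ⊛ y) ⊛ x        ≈⟨ *-congʳ s-y ⟩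
      (1# ⊕ x ⊛ s) ⊛ x   ≈⟨ distribʳ _ _ _ ⟩
      1# ⊛ x ⊕ (x ⊛ s) ⊛ x  ≈⟨ +-cong (≈-trans (*-identityˡ x) (≈-sym (*-identityʳ x))) (*-assoc _ _ _) ⟩
      x ⊛ 1# ⊕ x ⊛ (s ⊛ x)  ≈⟨ distribˡ _ _ _ ⟨
      x ⊛ (1# ⊕ s ⊛ x)   ≈⟨ *-congˡ y-s ⟨
      x ⊛ (y ⊛ s)        ≈⟨ *-assoc _ _ _ ⟨
      (x ⊛ y) ⊛ s        ∎

    s-centralises : Centralises s U
    s-centralises a b a∈U b∈U = ≈-trans (t-conj c d a b)
      (*-congʳ (reflexive (cong₂ t (fixed a∈U) (fixed b∈U))))
      where
      fixed : ∀ {z} → z ∈ U → tr (c , d) z ≡ z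
      fixed z∈U = tr-neq (λ { refl → c∉U z∈U }) (λ { refl → d∉U z∈U })

  exchange-commutes : ∀ {c d} U → Unique (d ∷ c ∷ U) → ∀ m → Commute (t c d) (A (d ∷ c ∷ U) m)
  -- The list `c ∷ []` contributes `δ` and no step, so `TwoSteps` does not apply; the one remaining
  -- factor is s + 0.
  exchange-commutes []        u = step-conj (δ-central _)
    (commute-⊕ ≈-refl (≈-trans (zeroʳ _) (≈-sym (zeroˡ _))))
  exchange-commutes U@(_ ∷ _) u =
    TwoSteps.commutes E.xy≈yx (centralises-A U E.s-centralises) E.s-sum E.s-prod
    where module E = Exchange u

  -- Conjugation by s interchanges c and d in the list, yet leaves the left side unchanged because s
  -- commutes with it.
  A-exchange : ∀ {c d} U → Unique (d ∷ c ∷ U) → ∀ m → A (d ∷ c ∷ U) m ≈ A (c ∷ d ∷ U) m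
  A-exchange {c} {d} U u m = begin
    A (d ∷ c ∷ U) m              ≈⟨ *-identityʳ _ ⟨
    A (d ∷ c ∷ U) m ⊛ 1#         ≈⟨ *-congˡ (t-square c d) ⟨
    A (d ∷ c ∷ U) m ⊛ (s ⊛ s)    ≈⟨ *-assoc _ _ _ ⟨
    (A (d ∷ c ∷ U) m ⊛ s) ⊛ s    ≈⟨ *-congʳ (exchange-commutes U u m) ⟨
    (s ⊛ A (d ∷ c ∷ U) m) ⊛ s    ≈⟨ *-congʳ (A-conj c d (d ∷ c ∷ U) m) ⟩
    (A (map (tr (c , d)) (d ∷ c ∷ U)) m ⊛ s) ⊛ s  ≡⟨ cong (λ V → (A V m ⊛ s) ⊛ s)
      (cong₂ _∷_ (tr-eqʳ c d) (cong₂ _∷_ (tr-eqˡ c d) (map-tr-fixed E.c∉U E.d∉U))) ⟩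
    (A (c ∷ d ∷ U) m ⊛ s) ⊛ s    ≈⟨ *-assoc _ _ _ ⟩
    A (c ∷ d ∷ U) m ⊛ (s ⊛ s)    ≈⟨ *-congˡ (t-square c d) ⟩
    A (c ∷ d ∷ U) m ⊛ 1#         ≈⟨ *-identityʳ _ ⟩
    A (c ∷ d ∷ U) m              ∎
    where
    module E = Exchange u
    s : Carrier
    s = t c d

  -- The case split is forced by the separate clause of A for singletons: only nonempty tails unfold
  -- to a `step`.
  A-prep : ∀ {c U V} → U ↭ V → (∀ m → A U m ≈ A V m) → ∀ m → A (c ∷ U) m ≈ A (c ∷ V) m
  A-prep {U = []}    {[]}    p eq m = ≈-refl
  A-prep {U = []}    {_ ∷ _} p eq m = contradiction (↭-sym p) PermP.¬x∷xs↭[]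
  A-prep {U = _ ∷ _} {[]}    p eq m = contradiction p PermP.¬x∷xs↭[]
  A-prep {U = _ ∷ _} {_ ∷ _} p eq m = step-cong eq (∑-↭ _ p) m

  A-↭ : ∀ {U V} → U ↭ V → Unique U → ∀ m → A U m ≈ A V m
  A-↭ refl                   u             m = ≈-refl
  A-↭ (prep c p)             (_ ∷ u)       m = A-prep p (A-↭ p u) m
  A-↭ (swap {xs = U} d c p)  u@(_ ∷ _ ∷ v) m = ≈-trans (A-exchange U u m)
    (A-prep (prep d p) (A-prep p (A-↭ p v)) m)
  A-↭ (trans p q)            u             m =
    ≈-trans (A-↭ p u m) (A-↭ q (Unique-resp-↭ p u) m)

  -- Star words

  ∑-listsOf : {X : Set} (S : List X) (ℓ : ℕ) (F : List X → Carrier) →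
    ∑ (listsOf S (suc ℓ)) F ≈ ∑ S (λ x → ∑ (listsOf S ℓ) (λ w → F (x ∷ w)))
  ∑-listsOf S ℓ F = ≈-trans (∑-concatMap _ S F)
    (∑-cong S (λ x _ → ∑-map (x ∷_) (listsOf S ℓ) F))

  module StarWords {k : ℕ} (ι : Fin k → Fin n) (c : Fin n) where

    starWord : List (Fin k) → Carrier
    starWord []      = 1#
    starWord (x ∷ w) = t (ι x) c ⊛ starWord w

    ∑-avoiding : ∀ x S ℓ (F : List (Fin k) → Carrier) →
      ∑ (listsOf S ℓ) (λ w → when (does (¬? (x ∈? w))) (F w)) ≈ ∑ (listsOf (S ─ x) ℓ) F
    ∑-avoiding x S zero    F = ≈-refl
    ∑-avoiding x S (suc ℓ) F = begin
      ∑ (listsOf S (suc ℓ)) (λ w → when (does (¬? (x ∈? w))) (F w))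
        ≈⟨ ∑-listsOf S ℓ _ ⟩
      ∑ S (λ y → ∑ (listsOf S ℓ) (λ w → when (does (¬? (x ∈? (y ∷ w)))) (F (y ∷ w))))
        ≈⟨ ∑-cong S (λ y _ → ∑-cong (listsOf S ℓ) (λ w _ → ≈-trans
             (reflexive (cong (λ b → when b (F (y ∷ w))) (not-∨ (does (x FinP.≟ y)) _)))
             (when-∧ (does (¬? (x FinP.≟ y))) _ _))) ⟩
      ∑ S (λ y → ∑ (listsOf S ℓ) (λ w →
        when (does (¬? (x FinP.≟ y))) (when (does (¬? (x ∈? w))) (F (y ∷ w)))))
        ≈⟨ ∑-cong S (λ y _ → when-∑ (does (¬? (x FinP.≟ y))) (listsOf S ℓ) _) ⟨
      ∑ S (λ y → when (does (¬? (x FinP.≟ y)))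
        (∑ (listsOf S ℓ) (λ w → when (does (¬? (x ∈? w))) (F (y ∷ w)))))
        ≈⟨ ∑-cong S (λ y _ → when-cong (does (¬? (x FinP.≟ y))) (∑-avoiding x S ℓ _)) ⟩
      ∑ S (λ y → when (does (¬? (x FinP.≟ y))) (∑ (listsOf (S ─ x) ℓ) (λ w → F (y ∷ w))))
        ≈⟨ ∑-filter (λ y → ¬? (x FinP.≟ y)) S _ ⟨
      ∑ (S ─ x) (λ y → ∑ (listsOf (S ─ x) ℓ) (λ w → F (y ∷ w)))
        ≈⟨ ∑-listsOf (S ─ x) ℓ F ⟨
      ∑ (listsOf (S ─ x) (suc ℓ)) F ∎

    -- The summands exclude each other. If x recurs in w, then w itself must cover S; if not, w
    -- cannot cover S, which contains x, and has to cover the remaining letters.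
    when-covers : ∀ {x : Fin k} {S} → x ∈ S → ∀ w g →
      when (does (covers? S (x ∷ w))) g
        ≈ when (does (covers? S w)) g ⊕ when (does (¬? (x ∈? w))) (when (does (covers? (S ─ x) w)) g)
    when-covers {x} {S} x∈S w g with x ∈? w
    ... | yes x∈w = ≈-trans
      (reflexive (cong (λ b → when b g) (does-⇔ (mk⇔ (covers-drop-∈ x∈w) (All.map there))
        (covers? S (x ∷ w)) (covers? S w))))
      (≈-sym (+-identityʳ _))
    ... | no x∉w = ≈-trans
      (reflexive (cong (λ b → when b g) (does-⇔ (mk⇔ (covers-remove x∉w) covers-restore)
        (covers? S (x ∷ w)) (covers? (S ─ x) w))))
      (≈-sym (≈-trans (+-congʳ (reflexive (cong (λ b → when b g)
        (dec-false (covers? S w) (λ cov → x∉w (All.lookup cov x∈S)))))) (+-identityˡ _)))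

    B : List (Fin k) → ℕ → Carrier
    B S ℓ = ∑ (listsOf S ℓ) (λ w → when (does (covers? S w)) (starWord w))

    B-suc : ∀ S ℓ → B S (suc ℓ) ≈ J c (map ι S) ⊛ B S ℓ ⊕ ∑ S (λ x → t (ι x) c ⊛ B (S ─ x) ℓ)
    B-suc S ℓ = begin
      B S (suc ℓ)
        ≈⟨ ∑-listsOf S ℓ _ ⟩
      ∑ S (λ x → ∑ (listsOf S ℓ) (λ w → when (does (covers? S (x ∷ w))) (t (ι x) c ⊛ starWord w)))
        ≈⟨ ∑-cong S (λ x x∈S → ≈-trans
             (∑-cong (listsOf S ℓ) (λ w _ → ≈-trans (when-⊛ (does (covers? S (x ∷ w))) _ _) (*-congˡ (when-covers x∈S w _))))
             (≈-sym (∑-distribˡ (listsOf S ℓ) _ _))) ⟩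
      ∑ S (λ x → t (ι x) c ⊛ ∑ (listsOf S ℓ) (λ w → when (does (covers? S w)) (starWord w)
        ⊕ when (does (¬? (x ∈? w))) (when (does (covers? (S ─ x) w)) (starWord w))))
        ≈⟨ ∑-cong S (λ x _ → ≈-trans
             (*-congˡ (≈-trans (∑-⊕ (listsOf S ℓ) _ _) (+-congˡ (∑-avoiding x S ℓ _))))
             (distribˡ _ _ _)) ⟩
      ∑ S (λ x → t (ι x) c ⊛ B S ℓ ⊕ t (ι x) c ⊛ B (S ─ x) ℓ)
        ≈⟨ ∑-⊕ S _ _ ⟩
      ∑ S (λ x → t (ι x) c ⊛ B S ℓ) ⊕ ∑ S (λ x → t (ι x) c ⊛ B (S ─ x) ℓ)
        ≈⟨ +-congʳ (≈-trans (*-congʳ (∑-map ι S _)) (∑-distribʳ S _ _)) ⟨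
      J c (map ι S) ⊛ B S ℓ ⊕ ∑ S (λ x → t (ι x) c ⊛ B (S ─ x) ℓ) ∎

    -- Too few letters cannot cover S. It is the base case m = 0 of `B≈A`, where the term with a
    -- recurring first letter has to vanish.
    B-short : ∀ ℓ S → Unique S → ℓ < length S → B S ℓ ≈ 0#
    B-short zero    (_ ∷ _) u _ = +-identityʳ _
    B-short (suc ℓ) S       u ℓ<S = begin
      B S (suc ℓ)  ≈⟨ B-suc S ℓ ⟩
      J c (map ι S) ⊛ B S ℓ ⊕ ∑ S (λ x → t (ι x) c ⊛ B (S ─ x) ℓ)
        ≈⟨ +-cong (≈-trans (*-congˡ (B-short ℓ S u (ℕP.<-trans (ℕP.n<1+n ℓ) ℓ<S))) (zeroʳ _))
             (∑-cong S (λ x x∈S → ≈-trans (*-congˡ (B-short ℓ (S ─ x) (─-unique x u)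
               (ℕP.≤-pred (subst (suc ℓ <_) (length-─ u x∈S) ℓ<S)))) (zeroʳ _))) ⟩
      0# ⊕ ∑ S (λ _ → 0#)  ≈⟨ ≈-trans (+-identityˡ _) (∑-0 S) ⟩
      0#                   ∎

    -- Conjugation puts `ι x` at the head in place of c. Order independence moves it back to its
    -- position in S, so the right side has the same A for every x and the sum over x factors.
    A-remove : ∀ {S x} → Unique (c ∷ map ι S) → Unique S → x ∈ S → ∀ m →
      t (ι x) c ⊛ A (c ∷ map ι (S ─ x)) m ≈ A (map ι S) m ⊛ t (ι x) c
    A-remove {S} {x} u uS x∈S m = ≈-trans (A-conj (ι x) c (c ∷ map ι (S ─ x)) m)
      (*-congʳ (≈-trans (reflexive (cong (λ V → A V m)
          (cong₂ _∷_ (tr-eqʳ (ι x) c) (map-tr-fixed ιx∉ c∉))))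
        (A-↭ (↭-sym p) (Unique-resp-↭ p (AllPairs.tail u)) m)))
      where
      p : map ι S ↭ ι x ∷ map ι (S ─ x)
      p = PermP.map⁺ ι (─-↭ uS x∈S)
      ιx∉ : ι x ∉ map ι (S ─ x)
      ιx∉ = UniqueP.Unique[x∷xs]⇒x∉xs (Unique-resp-↭ p (AllPairs.tail u))
      c∉ : c ∉ map ι (S ─ x)
      c∉ = UniqueP.Unique[x∷xs]⇒x∉xs (Unique-resp-↭ (prep c p) u) ∘ there

    B≈A : ∀ ℓ S m → ℓ ≡ length S + m → Unique (c ∷ map ι S) → B S ℓ ≈ A (c ∷ map ι S) m
    B≈A zero    []        m       refl u = +-identityʳ _
    B≈A (suc ℓ) []        (suc m) eq   u = ≈-refl
    B≈A (suc ℓ) S@(_ ∷ _) m       eq   u = begin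
      B S (suc ℓ)
        ≈⟨ B-suc S ℓ ⟩
      j ⊛ B S ℓ ⊕ ∑ S (λ x → t (ι x) c ⊛ B (S ─ x) ℓ)
        ≈⟨ +-congˡ (∑-cong S (λ x x∈S → *-congˡ (B≈A ℓ (S ─ x) m
             (ℕP.suc-injective (≡.trans eq (cong (_+ m) (length-─ uS x∈S))))
             (unique-removed x∈S)))) ⟩
      j ⊛ B S ℓ ⊕ ∑ S (λ x → t (ι x) c ⊛ A (c ∷ map ι (S ─ x)) m)
        ≈⟨ +-congˡ (∑-cong S (λ x x∈S → A-remove u uS x∈S m)) ⟩
      j ⊛ B S ℓ ⊕ ∑ S (λ x → A (map ι S) m ⊛ t (ι x) c)
        ≈⟨ +-congˡ (≈-trans (≈-sym (∑-distribˡ S _ _)) (*-congˡ (≈-sym (∑-map ι S _)))) ⟩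
      j ⊛ B S ℓ ⊕ A (map ι S) m ⊛ j
        ≈⟨ finish m eq ⟩
      A (c ∷ map ι S) m ∎
      where
      j : Carrier
      j = J c (map ι S)
      uS : Unique S
      uS = UniqueP.map⁻ (AllPairs.tail u)
      unique-removed : ∀ {x} → x ∈ S → Unique (c ∷ map ι (S ─ x))
      unique-removed x∈S = AllPairs.tail (Unique-resp-↭
        (trans (prep c (PermP.map⁺ ι (─-↭ uS x∈S))) (swap c _ ↭-refl)) u)
      j-A : ∀ m → Commute j (A (map ι S) m)
      j-A = centralises-A (map ι S) (J-centralises u)
      finish : ∀ m → suc ℓ ≡ length S + m →
        j ⊛ B S ℓ ⊕ A (map ι S) m ⊛ j ≈ A (c ∷ map ι S) m
      finish zero eq = ≈-trans (+-congʳ (≈-trans (*-congˡ (B-short ℓ S uS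
        (ℕP.≤-reflexive (≡.trans eq (ℕP.+-identityʳ _))))) (zeroʳ j))) (+-identityˡ _)
      finish (suc m) eq = begin
        j ⊛ B S ℓ ⊕ A (map ι S) (suc m) ⊛ j
          ≈⟨ +-congʳ (*-congˡ (B≈A ℓ S m (ℕP.suc-injective (≡.trans eq (ℕP.+-suc _ m))) u)) ⟩
        j ⊛ A (c ∷ map ι S) m ⊕ A (map ι S) (suc m) ⊛ j
          -- Star words lose their first letter, whereas `step` multiplies on the right; j has to be
          -- carried across A.
          ≈⟨ +-congʳ (step-conj j-A ≈-refl m) ⟩
        A (c ∷ map ι S) m ⊛ j ⊕ A (map ι S) (suc m) ⊛ j
          ≈⟨ distribʳ _ _ _ ⟨
        A (c ∷ map ι S) (suc m) ∎

  -- Monotone words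

  E : List (Fin n) → Carrier
  E []              = 1#
  E (c ∷ [])        = 1#
  E (c ∷ U@(_ ∷ _)) = E U ⊛ J c U

  -- H U m is the complete homogeneous polynomial h_m in the elements J.
  H : List (Fin n) → ℕ → Carrier
  H []      m       = δ m
  H (c ∷ U) zero    = 1#
  H (c ∷ U) (suc m) = H (c ∷ U) m ⊛ J c U ⊕ H U (suc m)

  centralises-H : ∀ {z} U → Centralises z U → ∀ m → Commute z (H U m)
  centralises-H []      h m       = δ-central _ m
  centralises-H (c ∷ U) h zero    = δ-central _ zero
  centralises-H (c ∷ U) h (suc m) = commute-⊕
    (commute-⊛ (centralises-H (c ∷ U) h m) (centralises-J h))
    (centralises-H U (centralises-tail h) (suc m))

  -- A multiplies in one factor j / (1 - T j) per symbol; collecting the numerators in E and the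
  -- geometric series in H requires moving j past `H U`, with which it commutes by `J-centralises`.
  A≈E⊛H : ∀ U → Unique U → ∀ m → A U m ≈ E U ⊛ H U m
  A≈E⊛H []       u m       = ≈-sym (*-identityˡ _)
  A≈E⊛H (c ∷ []) u zero    = ≈-sym (*-identityˡ _)
  A≈E⊛H (c ∷ []) u (suc m) = ≈-sym (≈-trans (*-identityˡ _)
    (≈-trans (+-identityʳ _) (zeroʳ _)))
  A≈E⊛H (c ∷ U@(_ ∷ _)) u zero = begin
    A U 0 ⊛ J c U         ≈⟨ *-congʳ (A≈E⊛H U (AllPairs.tail u) 0) ⟩
    (E U ⊛ 1#) ⊛ J c U    ≈⟨ *-congʳ (*-identityʳ _) ⟩
    E U ⊛ J c U           ≈⟨ *-identityʳ _ ⟨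
    (E U ⊛ J c U) ⊛ 1#    ∎
  A≈E⊛H (c ∷ U@(_ ∷ _)) u (suc m) = begin
    (A (c ∷ U) m ⊕ A U (suc m)) ⊛ j
      ≈⟨ distribʳ _ _ _ ⟩
    A (c ∷ U) m ⊛ j ⊕ A U (suc m) ⊛ j
      ≈⟨ +-cong (*-congʳ (A≈E⊛H (c ∷ U) u m)) (*-congʳ (A≈E⊛H U (AllPairs.tail u) (suc m))) ⟩
    ((E U ⊛ j) ⊛ H (c ∷ U) m) ⊛ j ⊕ (E U ⊛ H U (suc m)) ⊛ j
      ≈⟨ +-cong (*-assoc _ _ _) (≈-trans (*-assoc _ _ _)
           (≈-trans (*-congˡ (≈-sym (centralises-H U (J-centralises u) (suc m)))) (≈-sym (*-assoc _ _ _)))) ⟩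
    (E U ⊛ j) ⊛ (H (c ∷ U) m ⊛ j) ⊕ (E U ⊛ j) ⊛ H U (suc m)
      ≈⟨ distribˡ _ _ _ ⟨
    (E U ⊛ j) ⊛ H (c ∷ U) (suc m) ∎
    where
    j : Carrier
    j = J c U

  -- `listsOf` builds words from the front, but monotone words are decomposed at the last letter.
  ∑-listsOf-last : {X : Set} (S : List X) (ℓ : ℕ) (F : List X → Carrier) →
    ∑ (listsOf S (suc ℓ)) F ≈ ∑ S (λ x → ∑ (listsOf S ℓ) (λ w → F (w ∷ʳ x)))
  ∑-listsOf-last S zero    F = ∑-listsOf S zero F
  ∑-listsOf-last S (suc ℓ) F = begin
    ∑ (listsOf S (2 + ℓ)) F
      ≈⟨ ∑-listsOf S (suc ℓ) F ⟩
    ∑ S (λ y → ∑ (listsOf S (suc ℓ)) (λ w → F (y ∷ w)))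
      ≈⟨ ∑-cong S (λ y _ → ∑-listsOf-last S ℓ _) ⟩
    ∑ S (λ y → ∑ S (λ x → ∑ (listsOf S ℓ) (λ w → F (y ∷ w ∷ʳ x))))
      ≈⟨ ∑-swap S S _ ⟩
    ∑ S (λ x → ∑ S (λ y → ∑ (listsOf S ℓ) (λ w → F (y ∷ w ∷ʳ x))))
      ≈⟨ ∑-cong S (λ x _ → ∑-listsOf S ℓ _) ⟨
    ∑ S (λ x → ∑ (listsOf S (suc ℓ)) (λ w → F (w ∷ʳ x))) ∎

  transWord : List (Trans n) → Carrier
  transWord []            = 1#
  transWord ((a , b) ∷ w) = t a b ⊛ transWord w

  transWord-∷ʳ : ∀ w a b → transWord (w ∷ʳ (a , b)) ≈ transWord w ⊛ t a b
  transWord-∷ʳ []            a b = ≈-trans (*-identityʳ _) (≈-sym (*-identityˡ _))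
  transWord-∷ʳ ((c , d) ∷ w) a b = ≈-trans (*-congˡ (transWord-∷ʳ w a b)) (≈-sym (*-assoc _ _ _))

  M : ℕ → ℕ → Carrier
  M j m = ∑ (listsOf (allTrans n) m) (λ w → when (does (monotoneBelow? j w)) (transWord w))

  M-extend : ℕ → Trans n → Carrier
  M-extend m (a , b) = M (suc (toℕ b)) m ⊛ t a b

  M-suc : ∀ j m →
    M j (suc m) ≈ ∑ (allTrans n) (λ p → when (does (below? j p)) (M-extend m p))
  M-suc j m = begin
    M j (suc m)
      ≈⟨ ∑-listsOf-last (allTrans n) m _ ⟩
    ∑ (allTrans n) (λ p → ∑ W (λ w → when (does (monotoneBelow? j (w ∷ʳ p))) (transWord (w ∷ʳ p))))
      ≈⟨ ∑-cong (allTrans n) (λ p _ → ≈-trans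
           (∑-cong W (λ w _ → last-step p w))
           (≈-trans (≈-sym (when-∑ (does (below? j p)) W _))
             (when-cong (does (below? j p)) (≈-sym (∑-distribʳ W _ _))))) ⟩
    ∑ (allTrans n) (λ p → when (does (below? j p)) (M-extend m p)) ∎
    where
    W : List (List (Trans n))
    W = listsOf (allTrans n) m
    last-step : ∀ p w → when (does (monotoneBelow? j (w ∷ʳ p))) (transWord (w ∷ʳ p)) ≈
      when (does (below? j p))
        (when (does (monotoneBelow? (suc (toℕ (proj₂ p))) w)) (transWord w) ⊛ t (proj₁ p) (proj₂ p))
    last-step p@(a , b) w = begin
      when (does (monotoneBelow? j (w ∷ʳ p))) (transWord (w ∷ʳ p))
        ≡⟨ cong (λ e → when e (transWord (w ∷ʳ p))) (does-⇔ (monotoneBelow-∷ʳ j w p)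
             (monotoneBelow? j (w ∷ʳ p)) (below? j p ×-dec w?)) ⟩
      when (does (below? j p) ∧ does w?) (transWord (w ∷ʳ p))
        ≈⟨ when-∧ (does (below? j p)) (does w?) _ ⟩
      when (does (below? j p)) (when (does w?) (transWord (w ∷ʳ p)))
        ≈⟨ when-cong (does (below? j p)) (≈-trans (when-cong (does w?) (transWord-∷ʳ w a b))
             (when-⊛ˡ (does w?) _ _)) ⟩
      when (does (below? j p)) (when (does w?) (transWord w) ⊛ t a b) ∎
      where
      w? : Dec (MonotoneBelow (suc (toℕ b)) w)
      w? = monotoneBelow? (suc (toℕ b)) w

  when-below-suc : ∀ {c : Fin n} {j} → toℕ c ≡ j → ∀ (p : Trans n) x →
    when (does (below? (suc j) p)) x
      ≈ when (does (below? j p)) x ⊕ when (does (proj₂ p FinP.≟ c)) x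
  when-below-suc {c} {j} eq p@(a , b) x = by-cases (below? j p) (b FinP.≟ c)
    where
    by-cases : (d : Dec (Below j p)) (e : Dec (b ≡ c)) →
      when (does (below? (suc j) p)) x ≈ when (does d) x ⊕ when (does e) x
    by-cases (yes b<j) (yes refl) = contradiction b<j (ℕP.<-irrefl eq)
    by-cases (yes b<j) (no _) = ≈-trans
      (reflexive (cong (λ e → when e x) (dec-true (below? (suc j) p) (ℕP.m<n⇒m<1+n b<j))))
      (≈-sym (+-identityʳ x))
    by-cases (no _) (yes refl) = ≈-trans
      (reflexive (cong (λ e → when e x) (dec-true (below? (suc j) p) (s≤s (ℕP.≤-reflexive eq)))))
      (≈-sym (+-identityˡ x))
    by-cases (no b≮j) (no b≢c) = ≈-trans
      (reflexive (cong (λ e → when e x) (dec-false (below? (suc j) p) (λ b<1+j →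
        b≢c (FinP.toℕ-injective (≡.trans (ℕP.≤∧≮⇒≡ (ℕP.≤-pred b<1+j) b≮j) (≡.sym eq)))))))
      (≈-sym (+-identityˡ 0#))

  -- Sort by the last letter (a b). If b < c, all letters lie below c and the word is counted for U;
  -- if b = c, any admissible word may precede, which contributes `H (c ∷ U) m` times the element of
  -- c. This is the recursion of h_m.
  M≈H : ∀ {U} → Initial U → ∀ m → M (length U) m ≈ H U m
  M≈H []      zero    = +-identityʳ 1#
  M≈H []      (suc m) = ≈-trans (M-suc 0 m) (∑-0 (allTrans n))
  M≈H (_ ∷ i) zero    = +-identityʳ 1#
  M≈H {c ∷ U} i@(eq ∷ i′) (suc m) = begin
    M (suc (length U)) (suc m)
      ≈⟨ M-suc (suc (length U)) m ⟩
    ∑ (allTrans n) (λ p → when (does (below? (suc (length U)) p)) (M-extend m p))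
      ≈⟨ ∑-cong (allTrans n) (λ p _ → when-below-suc eq p _) ⟩
    ∑ (allTrans n) (λ p → when (does (below? (length U) p)) (M-extend m p)
      ⊕ when (does (proj₂ p FinP.≟ c)) (M-extend m p))
      ≈⟨ ∑-⊕ (allTrans n) _ _ ⟩
    ∑ (allTrans n) (λ p → when (does (below? (length U) p)) (M-extend m p))
      ⊕ ∑ (allTrans n) (λ p → when (does (proj₂ p FinP.≟ c)) (M-extend m p))
      ≈⟨ +-cong (≈-sym (M-suc (length U) m)) (≈-sym (∑-filter (λ p → proj₂ p FinP.≟ c) (allTrans n) _)) ⟩
    M (length U) (suc m) ⊕ ∑ (filter (λ p → proj₂ p FinP.≟ c) (allTrans n)) (M-extend m)
      ≈⟨ +-cong (M≈H i′ (suc m)) (≈-trans (∑-↭ _ (allTrans-ending-↭ i)) (∑-map (_, c) U _)) ⟩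
    H U (suc m) ⊕ ∑ U (λ a → M (suc (toℕ c)) m ⊛ t a c)
      ≈⟨ +-comm _ _ ⟩
    ∑ U (λ a → M (suc (toℕ c)) m ⊛ t a c) ⊕ H U (suc m)
      ≈⟨ +-congʳ (≈-trans (≈-sym (∑-distribˡ U _ _)) (*-congʳ
           (≈-trans (reflexive (cong (λ j → M (suc j) m) eq)) (M≈H i m)))) ⟩
    H (c ∷ U) m ⊛ J c U ⊕ H U (suc m) ∎

-- The semiring of maps with multiplicities

open CommutativeSemigroupP ℕP.+-commutativeSemigroup using ()
  renaming (interchange to +-interchange)

ev : ∀ {n} → List (Fun n) → (Fun n → ℕ) → ℕ
ev []      φ = 0
ev (f ∷ X) φ = φ f + ev X φ

Extensional : ∀ {n} → (Fun n → ℕ) → Set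
Extensional φ = ∀ {f g} → (∀ x → f x ≡ g x) → φ f ≡ φ g

infix 4 _≈ₗ_

-- Lists of maps up to multiplicity form the semiring ℕ[Fun n]; the product
-- composes from left to right.  Without function extensionality, equality is
-- tested against extensional weights.
record _≈ₗ_ {n : ℕ} (X Y : List (Fun n)) : Set where
  constructor mk≈
  field ev-≡ : ∀ φ → Extensional φ → ev X φ ≡ ev Y φ

open _≈ₗ_

infixl 7 _▷_ _▷ₗ_

_▷_ : ∀ {n} → Fun n → Fun n → Fun n
(f ▷ g) x = g (f x)

_▷ₗ_ : ∀ {n} → List (Fun n) → List (Fun n) → List (Fun n)
X ▷ₗ Y = concatMap (λ f → map (f ▷_) Y) X

ev-++ : ∀ {n} (X Y : List (Fun n)) φ → ev (X ++ Y) φ ≡ ev X φ + ev Y φ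
ev-++ []      Y φ = refl
ev-++ (f ∷ X) Y φ = ≡.trans (cong (φ f +_) (ev-++ X Y φ)) (≡.sym (ℕP.+-assoc (φ f) _ _))

ev-map : ∀ {n} (h : Fun n → Fun n) Y φ → ev (map h Y) φ ≡ ev Y (φ ∘ h)
ev-map h []      φ = refl
ev-map h (g ∷ Y) φ = cong (φ (h g) +_) (ev-map h Y φ)

ev-▷ₗ : ∀ {n} (X Y : List (Fun n)) φ → ev (X ▷ₗ Y) φ ≡ ev X (λ f → ev Y (λ g → φ (f ▷ g)))
ev-▷ₗ []      Y φ = refl
ev-▷ₗ (f ∷ X) Y φ = ≡.trans (ev-++ (map (f ▷_) Y) (X ▷ₗ Y) φ)
  (cong₂ _+_ (ev-map (f ▷_) Y φ) (ev-▷ₗ X Y φ))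

ev-cong : ∀ {n} (X : List (Fun n)) {φ ψ} → (∀ f → φ f ≡ ψ f) → ev X φ ≡ ev X ψ
ev-cong []      eq = refl
ev-cong (f ∷ X) eq = cong₂ _+_ (eq f) (ev-cong X eq)

ev-0 : ∀ {n} (X : List (Fun n)) → ev X (λ _ → 0) ≡ 0
ev-0 []      = refl
ev-0 (f ∷ X) = ev-0 X

ev-+ : ∀ {n} (X : List (Fun n)) φ ψ → ev X (λ f → φ f + ψ f) ≡ ev X φ + ev X ψ
ev-+ []      φ ψ = refl
ev-+ (f ∷ X) φ ψ = ≡.trans (cong (φ f + ψ f +_) (ev-+ X φ ψ)) (+-interchange (φ f) (ψ f) _ _)

-- For congruence of the product: summing out the right factor leaves a weight in the left factor,
-- which must again be extensional for the hypothesis on that factor to apply.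
ev-shift : ∀ {n} (Y : List (Fun n)) {φ} → Extensional φ → Extensional (λ f → ev Y (λ g → φ (f ▷ g)))
ev-shift Y ext f≗f′ = ev-cong Y (λ g → ext (λ x → cong g (f≗f′ x)))

funSemiring : ℕ → Semiring 0ℓ 0ℓ
funSemiring n = record
  { Carrier = List (Fun n)
  ; _≈_ = _≈ₗ_
  ; _+_ = _++_
  ; _*_ = _▷ₗ_
  ; 0#  = []
  ; 1#  = id ∷ []
  ; isSemiring = record
    { isSemiringWithoutAnnihilatingZero = record
      { +-isCommutativeMonoid = record
        { isMonoid = record
          { isSemigroup = record
            { isMagma = record
              { isEquivalence = record
                { refl  = mk≈ λ _ _ → refl
                ; sym   = λ p → mk≈ λ φ e → ≡.sym (ev-≡ p φ e)
                ; trans = λ p q → mk≈ λ φ e → ≡.trans (ev-≡ p φ e) (ev-≡ q φ e)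
                }
              ; ∙-cong = λ {X} {X′} {Y} {Y′} p q → mk≈ λ φ e → ≡.trans (ev-++ X Y φ)
                  (≡.trans (cong₂ _+_ (ev-≡ p φ e) (ev-≡ q φ e)) (≡.sym (ev-++ X′ Y′ φ)))
              }
            ; assoc = λ X Y Z → mk≈ λ φ _ → cong (λ V → ev V φ) (ListP.++-assoc X Y Z)
            }
          ; identity = (λ X → mk≈ λ _ _ → refl)
                     , (λ X → mk≈ λ φ _ → cong (λ V → ev V φ) (ListP.++-identityʳ X))
          }
        ; comm = λ X Y → mk≈ λ φ _ → ≡.trans (ev-++ X Y φ)
            (≡.trans (ℕP.+-comm (ev X φ) _) (≡.sym (ev-++ Y X φ)))
        }
      ; *-cong = λ {X} {X′} {Y} {Y′} p q → mk≈ λ φ e → ≡.trans (ev-▷ₗ X Y φ)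
          (≡.trans (ev-≡ p _ (ev-shift Y e)) (≡.trans
            (ev-cong X′ (λ f → ev-≡ q _ (λ g≗g′ → e (λ x → g≗g′ (f x)))))
            (≡.sym (ev-▷ₗ X′ Y′ φ))))
      ; *-assoc = λ X Y Z → mk≈ λ φ _ → ≡.trans (ev-▷ₗ (X ▷ₗ Y) Z φ) (≡.trans (ev-▷ₗ X Y _)
          (≡.sym (≡.trans (ev-▷ₗ X (Y ▷ₗ Z) φ) (ev-cong X (λ f → ev-▷ₗ Y Z _)))))
      ; *-identity = (λ X → mk≈ λ φ _ → ≡.trans (ev-▷ₗ (id ∷ []) X φ) (ℕP.+-identityʳ _))
                   , (λ X → mk≈ λ φ _ → ≡.trans (ev-▷ₗ X (id ∷ []) φ) (ev-cong X (λ f → ℕP.+-identityʳ _)))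
      ; distrib = (λ X Y Z → mk≈ λ φ _ → ≡.trans (ev-▷ₗ X (Y ++ Z) φ)
                    (≡.trans (ev-cong X (λ f → ev-++ Y Z _)) (≡.trans (ev-+ X _ _)
                      (≡.sym (≡.trans (ev-++ (X ▷ₗ Y) (X ▷ₗ Z) φ) (cong₂ _+_ (ev-▷ₗ X Y φ) (ev-▷ₗ X Z φ)))))))
                , (λ X Y Z → mk≈ λ φ _ → ≡.trans (ev-▷ₗ (Y ++ Z) X φ) (≡.trans (ev-++ Y Z _)
                      (≡.sym (≡.trans (ev-++ (Y ▷ₗ X) (Z ▷ₗ X) φ) (cong₂ _+_ (ev-▷ₗ Y X φ) (ev-▷ₗ Z X φ))))))
      }
    ; zero = (λ X → mk≈ λ _ _ → refl)
           , (λ X → mk≈ λ φ _ → ≡.trans (ev-▷ₗ X [] φ) (ev-0 X))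
    }
  }

++-cancelʳ-≈ : ∀ {n} → AlgDefs.RightCancellative (_≈ₗ_ {n}) _++_
++-cancelʳ-≈ Z X Y p = mk≈ λ φ e → ℕP.+-cancelʳ-≡ (ev Z φ) (ev X φ) (ev Y φ)
  (≡.trans (≡.sym (ev-++ X Z φ)) (≡.trans (ev-≡ p φ e) (ev-++ Y Z φ)))

singleton-≈ : ∀ {n} {f g : Fun n} → (∀ x → f x ≡ g x) → (f ∷ []) ≈ₗ (g ∷ [])
singleton-≈ f≗g = mk≈ λ φ e → cong (_+ 0) (e f≗g)

trₗ : ∀ {n} → Fin n → Fin n → List (Fun n)
trₗ a b = tr (a , b) ∷ []

-- From semiring identities to counts

module FunWords (n : ℕ) where

  open Semiring (funSemiring n) using (_≈_)
    renaming (_*_ to _⊛_; refl to ≈-refl; sym to ≈-sym; trans to ≈-trans;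
              +-cong to ⊕-cong; *-cong to ⊛-cong; *-congʳ to ⊛-congʳ; *-congˡ to ⊛-congˡ;
              zeroʳ to ⊛-zeroʳ; reflexive to ≈-reflexive)
  open Star (funSemiring n) ++-cancelʳ-≈ trₗ
    (λ a b → singleton-≈ (tr-involutive a b))
    (λ a b c d → singleton-≈ (tr-conj a b c d)) public
  open SetoidReasoning (Semiring.setoid (funSemiring n))

  starWord-≈ : ∀ {k} (ι : Fin k → Fin n) c w →
    StarWords.starWord ι c w ≈ prod (map (λ x → tr (ι x , c)) w) ∷ []
  starWord-≈ ι c []      = ≈-refl
  starWord-≈ ι c (x ∷ w) = ⊛-congˡ {trₗ (ι x) c} (starWord-≈ ι c w)

  transWord-≈ : ∀ w → transWord w ≈ prod (map tr w) ∷ []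
  transWord-≈ []            = ≈-refl
  transWord-≈ ((a , b) ∷ w) = ⊛-congˡ {trₗ a b} (transWord-≈ w)

  one-line : PermVec n → List (Fun n)
  one-line v = Vec.lookup v ∷ []

  -- Right multiplication by (b c) acts on the values of a permutation, hence is `Vec.map` in
  -- one-line notation; expanding the factor `J c U` thus produces exactly the insertions of c.
  E≈∑ : ∀ {c : Fin n} {U} → Initial (c ∷ U) → E (c ∷ U) ≈ ∑ (initialCycles (c ∷ U)) one-line
  E≈∑ {U = []}            i       = singleton-≈ (λ x → ≡.sym (VecP.lookup∘tabulate id x))
  E≈∑ {c} {U@(_ ∷ _)} (_ ∷ i) = begin
    E U ⊛ J c U
      ≈⟨ ⊛-congʳ {J c U} (E≈∑ i) ⟩
    ∑ (initialCycles U) one-line ⊛ J c U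
      ≈⟨ ∑-distribʳ (initialCycles U) (J c U) one-line ⟩
    ∑ (initialCycles U) (λ v → one-line v ⊛ J c U)
      ≈⟨ ∑-cong (initialCycles U) (λ v _ → ≈-trans (∑-distribˡ U (one-line v) (λ b → trₗ b c))
           (∑-cong U (λ b _ → singleton-≈ {f = Vec.lookup v ▷ tr (b , c)} (λ x → ≡.sym (VecP.lookup-map x (tr (b , c)) v))))) ⟩
    ∑ (initialCycles U) (λ v → ∑ U (λ b → one-line (Vec.map (tr (b , c)) v)))
      ≈⟨ ∑-cong (initialCycles U) (λ v _ → ∑-map _ U one-line) ⟨
    ∑ (initialCycles U) (λ v → ∑ (insertions c U v) one-line)
      ≈⟨ ∑-concatMap (insertions c U) (initialCycles U) one-line ⟨
    ∑ (initialCycles (c ∷ U)) one-line ∎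

  ∑-cartesianProduct : {X Y : Set} (xs : List X) (ys : List Y) (f : X × Y → List (Fun n)) →
    ∑ (cartesianProduct xs ys) f ≈ ∑ xs (λ x → ∑ ys (λ y → f (x , y)))
  ∑-cartesianProduct []       ys f = ≈-refl
  ∑-cartesianProduct (x ∷ xs) ys f = ≈-trans (∑-++ (map (x ,_) ys) (cartesianProduct xs ys) f)
    (⊕-cong (∑-map (x ,_) ys f) (∑-cartesianProduct xs ys f))

  -- As a weight, it extracts the coefficient of h.
  indicator : Fun n → Fun n → ℕ
  indicator h f = if does (f ≗ᶠ? h) then 1 else 0

  indicator-ext : ∀ h → Extensional (indicator h)
  indicator-ext h {f} {g} f≗g = cong (λ e → if e then 1 else 0) (does-⇔ (mk⇔
    (All.map (λ {x} p → ≡.trans (≡.sym (f≗g x)) p)) (All.map (λ {x} p → ≡.trans (f≗g x) p)))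
    (f ≗ᶠ? h) (g ≗ᶠ? h))

  -- The guard b carries the conditions on a tuple apart from its product, and the weight tests the
  -- product, so each tuple satisfying P contributes 1 and every other tuple 0.
  count-∑ : {X : Set} {P : X → Set} (P? : ∀ x → Dec (P x)) (h : Fun n) (xs : List X)
    (F : X → List (Fun n)) (b : X → Bool) (f : X → Fun n) →
    (∀ x → F x ≈ when (b x) (f x ∷ [])) → (∀ x → does (P? x) ≡ b x ∧ does (f x ≗ᶠ? h)) →
    ev (∑ xs F) (indicator h) ≡ length (filter P? xs)
  count-∑ P? h []       F b f F≈ P≡ = refl
  count-∑ P? h (x ∷ xs) F b f F≈ P≡ = ≡.trans (ev-++ (F x) (∑ xs F) (indicator h))
    (≡.trans (cong₂ _+_ (≡.trans (ev-≡ (F≈ x) (indicator h) (indicator-ext h)) (weight (b x)))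
      (count-∑ P? h xs F b f F≈ P≡)) (length-step (P≡ x)))
    where
    weight : ∀ b → ev (when b (f x ∷ [])) (indicator h) ≡ (if b ∧ does (f x ≗ᶠ? h) then 1 else 0)
    weight true  = ℕP.+-identityʳ _
    weight false = refl
    length-step : ∀ {e} → does (P? x) ≡ e →
      (if e then 1 else 0) + length (filter P? xs) ≡ length (filter P? (x ∷ xs))
    length-step refl with does (P? x)
    ... | true  = refl
    ... | false = refl

  when-▷ : ∀ b c (f g : Fun n) → when b (f ∷ []) ⊛ when c (g ∷ []) ≈ when (b ∧ c) ((f ▷ g) ∷ [])
  when-▷ true  true  f g = ≈-refl
  when-▷ true  false f g = ⊛-zeroʳ (f ∷ [])
  when-▷ false c     f g = ≈-refl

  star-count : ∀ {k} (ι : Fin k → Fin n) c {m} (h : Fun n) → Unique (c ∷ map ι (allFin k)) →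
    ev (A (c ∷ map ι (allFin k)) m) (indicator h)
      ≡ length (filter (λ w → (prod (map (λ x → tr (ι x , c)) w) ≗ᶠ? h) ×-dec covers? (allFin k) w)
          (listsOf (allFin k) (k + m)))
  star-count {k} ι c {m} h u = ≡.trans
    (≡.sym (ev-≡ (StarWords.B≈A ι c (k + m) (allFin k) m (cong (_+ m) (≡.sym (ListP.length-tabulate id))) u)
      (indicator h) (indicator-ext h)))
    (count-∑ _ h (listsOf (allFin k) (k + m)) _ (λ w → does (covers? (allFin k) w))
      (λ w → prod (map (λ x → tr (ι x , c)) w))
      (λ w → when-cong (does (covers? (allFin k) w)) (starWord-≈ ι c w))
      (λ w → ∧-comm (does (prod (map (λ x → tr (ι x , c)) w) ≗ᶠ? h)) _))

  md-count : ∀ m (ω : Permutation′ n) {c U} → Initial (c ∷ U) → length (c ∷ U) ≡ n →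
    ev (A (c ∷ U) m) (indicator (ω ⟨$⟩ʳ_))
      ≡ length (filter (mdCond? ω) (cartesianProduct (allPerms n) (listsOf (allTrans n) m)))
  md-count m ω {c} {U} i len = ≡.trans
    (ev-≡ total (indicator ω′) (indicator-ext ω′))
    (count-∑ (mdCond? ω) ω′ (cartesianProduct (allPerms n) W) _
      (λ (v , w) → does (isFullCycle? v) ∧ does (monotone? w))
      (λ (v , w) → Vec.lookup v ▷ prod (map tr w))
      (λ (v , w) → summand v w)
      (λ (v , w) → ≡.sym (∧-assoc (does (isFullCycle? v)) _ _)))
    where
    ω′ : Fun n
    ω′ = ω ⟨$⟩ʳ_
    W : List (List (Trans n))
    W = listsOf (allTrans n) m
    term : PermVec n × List (Trans n) → List (Fun n)
    term (v , w) = when (does (isFullCycle? v)) (one-line v) ⊛ when (does (monotoneBelow? n w)) (transWord w)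
    total : A (c ∷ U) m ≈ ∑ (cartesianProduct (allPerms n) W) term
    total = begin
      A (c ∷ U) m
        ≈⟨ A≈E⊛H (c ∷ U) (initial-unique i) m ⟩
      E (c ∷ U) ⊛ H (c ∷ U) m
        ≈⟨ ⊛-cong
             (≈-trans (E≈∑ i) (≈-trans (∑-↭ one-line (↭-sym (fullCycles-↭ i len))) (∑-filter isFullCycle? (allPerms n) one-line)))
             (≈-trans (≈-sym (M≈H i m)) (≈-reflexive (cong (λ j → M j m) len))) ⟩
      ∑ (allPerms n) (λ v → when (does (isFullCycle? v)) (one-line v)) ⊛ M n m
        ≈⟨ ∑-distribʳ (allPerms n) _ _ ⟩
      ∑ (allPerms n) (λ v → when (does (isFullCycle? v)) (one-line v) ⊛ M n m)
        ≈⟨ ∑-cong (allPerms n) (λ v _ → ∑-distribˡ W (when (does (isFullCycle? v)) (one-line v)) _) ⟩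
      ∑ (allPerms n) (λ v → ∑ W (λ w → term (v , w)))
        ≈⟨ ∑-cartesianProduct (allPerms n) W term ⟨
      ∑ (cartesianProduct (allPerms n) W) term ∎
    summand : ∀ v w → term (v , w) ≈
      when (does (isFullCycle? v) ∧ does (monotone? w)) ((Vec.lookup v ▷ prod (map tr w)) ∷ [])
    summand v w = ≈-trans
      (⊛-cong {when (does (isFullCycle? v)) (one-line v)} ≈-refl (≈-trans
        -- Every symbol lies below n, so at j = n the bound holds for all words.
        (≈-reflexive (cong (λ e → when e (transWord w)) (does-⇔ (mk⇔ proj₁ (λ mono → mono , All.tabulate (λ {p} _ → FinP.toℕ<n (proj₂ p))))
          (monotoneBelow? n w) (monotone? w))))
        (when-cong (does (monotone? w)) (transWord-≈ w))))
      (when-▷ (does (isFullCycle? v)) (does (monotone? w)) (Vec.lookup v) (prod (map tr w)))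

-- The two symbol lists and the comparison

∈-star-list : ∀ {k} (x : Fin (suc k)) → x ∈ fromℕ k ∷ map inject₁ (allFin k)
∈-star-list x with view x
... | ‵fromℕ     = here refl
... | ‵inject₁ i = there (∈-map⁺ inject₁ (∈-allFin i))

star-list-unique : ∀ k → Unique (fromℕ k ∷ map inject₁ (allFin k))
star-list-unique k = All.tabulate (λ x∈ → fresh (∈-map⁻ inject₁ x∈))
  ∷ UniqueP.map⁺ FinP.inject₁-injective (UniqueP.allFin⁺ k)
  where
  fresh : ∀ {x} → ∃ (λ i → i ∈ allFin k × x ≡ inject₁ i) → fromℕ k ≢ x
  fresh (_ , _ , refl) = FinP.fromℕ≢inject₁

star-list-↭ : ∀ {k} {U : List (Fin (suc k))} → Initial U → length U ≡ suc k →
  fromℕ k ∷ map inject₁ (allFin k) ↭ U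
star-list-↭ i len = unique-set⇒↭ (star-list-unique _) (initial-unique i)
  (λ {x} _ → initial-∈ i (subst (toℕ x <_) (≡.sym len) (FinP.toℕ<n x)))
  (λ {x} _ → ∈-star-list x)

-- Star words are longer than monotone words by k = n - 1, the shift in `B≈A`, so both counts use
-- the same m. The bound on c keeps `c ∸ 1` from truncating.
star-length : ∀ k c g → 1 ≤ c → suc k + c ∸ 2 + g ≡ k + (c ∸ 1 + g)
star-length k (suc c) g _ = ≡.trans (cong (λ m → m ∸ 1 + g) (ℕP.+-suc k c)) (ℕP.+-assoc k c g)

theorem1p4 : (k : ℕ) (ω : Permutation′ (suc k)) (g : ℕ) → a g ω ≡ md g ω
theorem1p4 k ω g with initial-exists (suc k) ℕP.≤-refl
... | U@(_ ∷ _) , i , len = begin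
  a g ω
    ≡⟨ cong (λ ℓ → length (filter (starCond? ω) (listsOf (allFin k) ℓ)))
         (star-length k (c ω) (2 * g) (cycles≥1 (ω ⟨$⟩ʳ_))) ⟩
  length (filter (starCond? ω) (listsOf (allFin k) (k + m)))
    ≡⟨ star-count inject₁ (fromℕ k) {m} (ω ⟨$⟩ʳ_) (star-list-unique k) ⟨
  ev (A (fromℕ k ∷ map inject₁ (allFin k)) m) (indicator (ω ⟨$⟩ʳ_))
    -- The star list runs n, 1, ..., n - 1 and the initial list n, n - 1, ..., 1; order independence
    -- identifies their coefficients.
    ≡⟨ ev-≡ (A-↭ (star-list-↭ i len) (star-list-unique k) m) _ (indicator-ext (ω ⟨$⟩ʳ_)) ⟩
  ev (A U m) (indicator (ω ⟨$⟩ʳ_))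
    ≡⟨ md-count m ω i len ⟩
  md g ω ∎
  where
  open ≡.≡-Reasoning
  open FunWords (suc k)
  m : ℕ
  m = c ω ∸ 1 + 2 * g
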